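{- Let $n\ge 2$, $k\ge1$, $t\ge1$ be integers and let $D$ be a target distribution on $G=P_n^{(k)}$ of size $t$. Then $\pi(G,D)\le p_t(n,k)-s(D)+1$. In addition, if $G$ is $t$-wide then $G$ is $D$-small, while if $G$ is strictly $t$-long then every configuration $C$ on $G$ of size $|C|\ge p_t(n,k)-s(D)+1$ solves every target $v$ with $D(v)>0$ with cost at most $2^{\mathrm{ecc}_G(v)}$.
   Context: $P_n^{(k)}$ has vertices $v_1,\dots,v_n$ with $v_i\sim v_j$ iff $1\le|i-j|\le k$. For $n\ge2$: $d=\lfloor (n-2)/k\rfloor+1$, $b=(n-2)-k(d-1)$, $p_t(n,k)=\max\{t2^d+b,\ 2t+n-2\}$. Let $t_0=1$ if $d=1$ and $t_0=k(d-1)/(2^d-2)$ if $d\ge 2$; $G$ is $t$-wide if $t\le t_0$ and strictly $t$-long if $t>\lceil t_0\rceil$. A configuration is $C:V\to\mathbb{N}$ with $|C|=\sum_vC(v)$; a target distribution is $D:V\to\mathbb{N}$ with size $\sum_vD(v)$ and $s(D)=|\{v:D(v)>0\}|$. A pebbling step from a vertex with at least two pebbles to a neighbor removes two pebbles there and adds one to the neighbor. $C$ is $D$-solvable if some sequence of pebbling steps results in at least $D(v)$ pebbles on every $v$ simultaneously; $\pi(G,D)$ is the least $m$ such that every configuration of size at least $m$ is $D$-solvable. The potential of $C$ with respect to $D$ is $\mathrm{pot}_D(C)=\sum_v\big(\min\{C(v),D(v)\}+\lfloor\max\{C(v)-D(v),0\}/2\rfloor\big)$. $G$ is $D$-small if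 some configuration $C$ that is not $D$-solvable and has $|C|=\pi(G,D)-1$ satisfies $\mathrm{pot}_D(C)=|D|-1$. The cost of a sequence of $c$ pebbling steps placing a pebble on $v$ is $c+1$; "$C$ solves $v$ with cost at most $x$" means such a sequence from $C$ exists with cost at most $x$. $\mathrm{ecc}_G(v)$ is the largest distance in $G$ from $v$. -}

module Defs where

open import Data.Nat using (ℕ; zero; suc; _+_; _*_; _∸_; _^_; _≤_; _<_; _⊔_; ∣_-_∣; NonZero; >-nonZero; s≤s; z≤n)
open import Data.Nat.Properties using (m<n⇒0<n∸m; *-monoʳ-<; m^n>0; *-mono-≤; ≤-refl)
open import Data.Nat.DivMod using (_/_)
open import Data.Fin using (Fin; toℕ; _≟_)
open import Data.List using (List; tabulate)
open import Data.Nat.ListAction using (sum)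
open import Data.Product using (Σ; ∃; ∃-syntax; _×_; _,_)
open import Relation.Nullary using (yes; no)
import Data.Rational as ℚ
open import Data.Integer using (ℤ; +_)

-- The graph P_n^(k): vertices Fin n (v_1..v_n ↦ 0..n-1),
-- i ~ j iff 1 ≤ |i - j| ≤ k.

Adj : {n : ℕ} (k : ℕ) → Fin n → Fin n → Set
Adj k i j = (1 ≤ ∣ toℕ i - toℕ j ∣) × (∣ toℕ i - toℕ j ∣ ≤ k)

data Walk {n : ℕ} (k : ℕ) : Fin n → Fin n → ℕ → Set where
  here : ∀ {u} → Walk k u u 0
  there : ∀ {u w v ℓ} → Adj k u w → Walk k w v ℓ → Walk k u v (suc ℓ)

IsDist : {n : ℕ} (k : ℕ) → Fin n → Fin n → ℕ → Set
IsDist k u v d = Walk k u v d × (∀ ℓ → Walk k u v ℓ → d ≤ ℓ)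

IsEcc : {n : ℕ} (k : ℕ) → Fin n → ℕ → Set
IsEcc {n} k v e =
  (∀ (u : Fin n) → ∃[ d ] (IsDist k v u d × d ≤ e)) × (∃[ u ] IsDist k v u e)

Config : ℕ → Set
Config n = Fin n → ℕ

size : {n : ℕ} → Config n → ℕ
size C = sum (tabulate C)

support : {n : ℕ} → Config n → ℕ
support D = sum (tabulate (λ v → supp1 (D v)))
  where
  supp1 : ℕ → ℕ
  supp1 zero = 0
  supp1 (suc _) = 1

move : {n : ℕ} → Fin n → Fin n → Config n → Config n
move u v C w = rem (w ≟ u) + add (w ≟ v)
  where
  rem : _ → ℕ
  rem (yes _) = C w ∸ 2
  rem (no _) = C w
  add : _ → ℕ
  add (yes _) = 1
  add (no _) = 0

data Steps {n : ℕ} (k : ℕ) : ℕ → Config n → Config n → Set where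
  done : ∀ {C} → Steps k 0 C C
  step : ∀ {c C C'} (u v : Fin n) → Adj k u v → 2 ≤ C u →
         Steps k c (move u v C) C' → Steps k (suc c) C C'

Solvable : {n : ℕ} (k : ℕ) → Config n → Config n → Set
Solvable {n} k D C = ∃[ c ] ∃[ C' ] (Steps k c C C' × (∀ (v : Fin n) → D v ≤ C' v))

AllSolvableFrom : {n : ℕ} (k : ℕ) → Config n → ℕ → Set
AllSolvableFrom {n} k D m = ∀ (C : Config n) → m ≤ size C → Solvable k D C

IsPebblingNumber : {n : ℕ} (k : ℕ) → Config n → ℕ → Set
IsPebblingNumber k D m =
  AllSolvableFrom k D m × (∀ m' → m' < m → AllSolvableFrom k D m' → Data.Empty.⊥)
  where import Data.Empty

pot : {n : ℕ} → Config n → Config n → ℕ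
pot D C = sum (tabulate (λ v → (C v Data.Nat.⊓ D v) + ((C v ∸ D v) / 2)))
  where import Data.Nat

Small : {n : ℕ} (k : ℕ) → Config n → Set
Small {n} k D = ∃[ m ] (IsPebblingNumber k D m ×
  ∃[ C ] (size C + 1 Relation.Binary.PropositionalEquality.≡ m
          × (Solvable k D C → Data.Empty.⊥)
          × pot D C + 1 Relation.Binary.PropositionalEquality.≡ size D))
  where
  import Data.Empty
  import Relation.Binary.PropositionalEquality

SolvesWithCost : {n : ℕ} (k : ℕ) → Config n → Fin n → ℕ → Set
SolvesWithCost k C v x = ∃[ c ] ∃[ C' ] (Steps k c C C' × 1 ≤ C' v × suc c ≤ x)

dP : ℕ → (k : ℕ) → .{{NonZero k}} → ℕ
dP n k = (n ∸ 2) / k + 1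

bP : ℕ → (k : ℕ) → .{{NonZero k}} → ℕ
bP n k = (n ∸ 2) ∸ k * (dP n k ∸ 1)

pP : ℕ → ℕ → (k : ℕ) → .{{NonZero k}} → ℕ
pP t n k = (t * 2 ^ dP n k + bP n k) ⊔ (2 * t + n ∸ 2)

2<2^[2+e] : ∀ e → 2 < 2 ^ suc (suc e)
2<2^[2+e] e = *-monoʳ-< 2 (*-mono-≤ (≤-refl {2}) (m^n>0 2 e))

nonZero-2^[2+e]∸2 : ∀ e → NonZero (2 ^ suc (suc e) ∸ 2)
nonZero-2^[2+e]∸2 e = >-nonZero (m<n⇒0<n∸m (2<2^[2+e] e))

t0Of : ℕ → ℕ → ℚ.ℚ
t0Of zero k = ℚ.0ℚ          -- d = 0 never occurs (d ≥ 1)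
t0Of (suc zero) k = ℚ.1ℚ
t0Of (suc (suc e)) k = ((+ (k * suc e)) ℚ./ (2 ^ suc (suc e) ∸ 2)) {{nonZero-2^[2+e]∸2 e}}

t0 : ℕ → (k : ℕ) → .{{NonZero k}} → ℚ.ℚ
t0 n k = t0Of (dP n k) k

Wide : ℕ → ℕ → (k : ℕ) → .{{NonZero k}} → Set
Wide t n k = (+ t ℚ./ 1) ℚ.≤ t0 n k

StrictlyLong : ℕ → ℕ → (k : ℕ) → .{{NonZero k}} → Set
StrictlyLong t n k = ℚ.ceiling (t0 n k) Data.Integer.< + t
  where import Data.Integer

{-# OPTIONS --safe #-}

-- The maximum defining p_t(n,k) is that of t 2^(e+1) + (n−2) − k e over all e with k e ≤ n − 2, a function convex in e.
-- In the form t 2^(e+1) + (n−1) ≤ |C| + s(D) + k e for all these e, the hypothesis passes to smaller instances term by term,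
-- which gives an induction on n + |C|.  If an end of the path is a target, then either a pebble within distance k of it
-- can be set aside to halve the cost of one demand, or there is none and all targets among the first k vertices are moved by k.
-- If no end is a target, the targets v₁ ≤ … ≤ v_t are served from the left as long as the pebbles left of them suffice;
-- when v_i fails, superadditivity of the bound shows that the pebbles right of v_i serve v_i, …, v_t.
-- For cheap solutions, the size forces 2^(d−1) disjoint pairs of pebbles, so one side of v has enough pairs by itself.
module Submission where

open import Defs
open import Data.Nat using (ℕ; zero; suc; pred; _+_; _*_; _∸_; _^_; _≤_; _<_; _⊓_; _⊔_; z≤n; s≤s; ∣_-_∣; _≟_; _≤?_; _<?_; ⌊_/2⌋; ⌈_/2⌉; NonZero; ≢-nonZero⁻¹)
open import Data.Nat.Properties
open import Data.Nat.DivMod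
open import Data.Nat.Divisibility using (divides)
open import Data.Nat.ListAction using (sum)
open import Data.Nat.Tactic.RingSolver using (solve-∀)
open import Data.Fin using (Fin; zero; suc; toℕ; fromℕ<; fromℕ) renaming (_≟_ to _≟ᶠ_)
open import Data.Fin.Properties using (toℕ-injective; toℕ<n; toℕ-fromℕ<; toℕ-fromℕ; any?)
import Data.Integer as ℤ
import Data.Integer.Properties as ℤ
import Data.Integer.DivMod as ℤ
open import Data.List using (tabulate)
open import Data.Product using (Σ; ∃-syntax; _×_; _,_; proj₁; proj₂)
open import Data.Rational as ℚ using (↥_; ↧_)
import Data.Rational.Properties as ℚ
open import Data.Rational.Unnormalised as ℚᵘ using (mkℚᵘ)
import Data.Rational.Unnormalised.Properties as ℚᵘ
open import Data.Sum using (_⊎_; inj₁; inj₂)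
open import Function using (_∘_; id)
open import Relation.Nullary using (yes; no; ¬_; contradiction)
open import Relation.Nullary.Decidable using (_×-dec_)
open import Relation.Binary.PropositionalEquality using (_≡_; _≢_; refl; sym; trans; cong; cong₂; subst; subst₂)

-- The accounting is tightest in the term `e = 0`, where one demand is worth exactly two units of
-- |C| + s(D). A reduction that drops a demand may therefore consume one pebble and one unit of
-- support; one that drops none must find each lost unit elsewhere: in a deleted vertex, in a new
-- target, or in a reserve kept for this purpose. This decides which replacements are possible near
-- an end. Moving past k vertices turns the term of `e + 1` into that of `e`. Only the demands among
-- the first k vertices double, so those beyond have a factor two to spare, which pays for the
-- support lost when two targets merge. In the split at v_i, one demand of v_i enters both counts,
-- so that the demands and the values |C| + s(D) of the two parts each add up to one more than for
-- the whole; superadditivity is wanted with just this correction. In the wide case the bound is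
-- attained because of parity: an odd pile off the targets wastes a pebble.

-- Configurations as functions on positions 0..m

-- Linear arithmetic: the equation is discharged by the ring solver.
linear : ∀ {a b c d} s → c ≤ d → a + d + s ≡ b + c → a ≤ b
linear {a} {b} {c} {d} s c≤d eq = +-cancelʳ-≤ c a b (≤-trans (≤-trans (+-monoʳ-≤ a c≤d) (m≤m+n (a + d) s)) (≤-reflexive eq))

infixl 6 _⟨+⟩_
_⟨+⟩_ : ∀ {a b c d} → a ≤ b → c ≤ d → a + c ≤ b + d
_⟨+⟩_ = +-mono-≤

infixl 6 _⊕_
_⊕_ : (ℕ → ℕ) → (ℕ → ℕ) → ℕ → ℕ
(f ⊕ g) x = f x + g x

pile : ℕ → ℕ → ℕ → ℕ
pile zero    a zero    = a
pile zero    a (suc x) = 0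
pile (suc i) a zero    = 0
pile (suc i) a (suc x) = pile i a x

upd : (ℕ → ℕ) → ℕ → ℕ → ℕ → ℕ
upd f zero    a zero    = a
upd f zero    a (suc x) = f (suc x)
upd f (suc i) a zero    = f 0
upd f (suc i) a (suc x) = upd (f ∘ suc) i a x

cons : ℕ → (ℕ → ℕ) → ℕ → ℕ
cons a f zero    = a
cons a f (suc x) = f x

cut : ℕ → (ℕ → ℕ) → ℕ → ℕ
cut zero    f zero    = f 0
cut zero    f (suc x) = 0
cut (suc p) f zero    = f 0
cut (suc p) f (suc x) = cut p (f ∘ suc) x

shift : ℕ → (ℕ → ℕ) → ℕ → ℕ
shift zero    f = f
shift (suc p) f = cons 0 (shift p f)

total : (ℕ → ℕ) → ℕ → ℕ
total f zero    = 0
total f (suc n) = f 0 + total (f ∘ suc) n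

occ : ℕ → ℕ
occ zero    = 0
occ (suc _) = 1

occ≤1 : ∀ x → occ x ≤ 1
occ≤1 zero    = z≤n
occ≤1 (suc x) = ≤-refl

occ≤ : ∀ x → occ x ≤ x
occ≤ zero    = z≤n
occ≤ (suc x) = s≤s z≤n

occ-pos : ∀ {x} → 0 < x → occ x ≡ 1
occ-pos (s≤s _) = refl

occ-mono : ∀ {x y} → x ≤ y → occ x ≤ occ y
occ-mono z≤n     = z≤n
occ-mono (s≤s _) = ≤-refl

spt : (ℕ → ℕ) → ℕ → ℕ
spt f = total (occ ∘ f)

pile-+ : ∀ i a b x → pile i a x + pile i b x ≡ pile i (a + b) x
pile-+ zero    a b zero    = refl
pile-+ zero    a b (suc x) = refl
pile-+ (suc i) a b zero    = refl
pile-+ (suc i) a b (suc x) = pile-+ i a b x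

pile-0 : ∀ i x → pile i 0 x ≡ 0
pile-0 zero    zero    = refl
pile-0 zero    (suc x) = refl
pile-0 (suc i) zero    = refl
pile-0 (suc i) (suc x) = pile-0 i x

pile-shift : ∀ p i a x → shift p (pile i a) x ≡ pile (p + i) a x
pile-shift zero    i a x       = refl
pile-shift (suc p) i a zero    = refl
pile-shift (suc p) i a (suc x) = pile-shift p i a x

pile-self : ∀ i a → pile i a i ≡ a
pile-self zero    a = refl
pile-self (suc i) a = pile-self i a

pile-≢ : ∀ {i x} a → i ≢ x → pile i a x ≡ 0
pile-≢ {zero}  {zero}  a i≢x = contradiction refl i≢x
pile-≢ {zero}  {suc x} a i≢x = refl
pile-≢ {suc i} {zero}  a i≢x = refl
pile-≢ {suc i} {suc x} a i≢x = pile-≢ {i} {x} a (i≢x ∘ cong suc)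

upd-self : ∀ f i a → upd f i a i ≡ a
upd-self f zero    a = refl
upd-self f (suc i) a = upd-self (f ∘ suc) i a

upd-≢ : ∀ f {i x} a → i ≢ x → upd f i a x ≡ f x
upd-≢ f {zero}  {zero}  a i≢x = contradiction refl i≢x
upd-≢ f {zero}  {suc x} a i≢x = refl
upd-≢ f {suc i} {zero}  a i≢x = refl
upd-≢ f {suc i} {suc x} a i≢x = upd-≢ (f ∘ suc) {i} {x} a (i≢x ∘ cong suc)

upd-pile-≤ : ∀ f i {a c} x → a + c ≤ f i → upd f i a x + pile i c x ≤ f x
upd-pile-≤ f zero    zero    h = h
upd-pile-≤ f zero    (suc x) h = ≤-reflexive (+-identityʳ (f (suc x)))
upd-pile-≤ f (suc i) zero    h = ≤-reflexive (+-identityʳ (f 0))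
upd-pile-≤ f (suc i) (suc x) h = upd-pile-≤ (f ∘ suc) i x h

≤-upd : ∀ f i {a} x → f i ≤ a → f x ≤ upd f i a x
≤-upd f zero    zero    h = h
≤-upd f zero    (suc x) h = ≤-refl
≤-upd f (suc i) zero    h = ≤-refl
≤-upd f (suc i) (suc x) h = ≤-upd (f ∘ suc) i x h

≤-upd-pile : ∀ f i {a b c} x → f i + b ≤ a + c → f x + pile i b x ≤ upd f i a x + pile i c x
≤-upd-pile f zero    zero    h = h
≤-upd-pile f zero    (suc x) h = ≤-refl
≤-upd-pile f (suc i) zero    h = ≤-refl
≤-upd-pile f (suc i) (suc x) h = ≤-upd-pile (f ∘ suc) i x h

cut-≤ : ∀ p f x → x ≤ p → cut p f x ≡ f x
cut-≤ zero    f zero    _       = refl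
cut-≤ (suc p) f zero    _       = refl
cut-≤ (suc p) f (suc x) (s≤s h) = cut-≤ p (f ∘ suc) x h

cut-> : ∀ p f x → p < x → cut p f x ≡ 0
cut-> zero    f (suc x) _       = refl
cut-> (suc p) f (suc x) (s≤s h) = cut-> p (f ∘ suc) x h

-- Glues two pieces that share position `p`: the left piece keeps its value there and the right
-- piece contributes `a` on top.
cut-shift : ∀ p f g a → (∀ y → g y ≡ f (suc (p + y))) → ∀ x → cut p f x + shift p (cons a g) x ≡ f x + pile p a x
cut-shift zero    f g a g≡ zero    = refl
cut-shift zero    f g a g≡ (suc x) = trans (g≡ x) (sym (+-identityʳ (f (suc x))))
cut-shift (suc p) f g a g≡ zero    = refl
cut-shift (suc p) f g a g≡ (suc x) = cut-shift p (f ∘ suc) g a g≡ x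

total-cong : ∀ {f g} n → (∀ x → x < n → f x ≡ g x) → total f n ≡ total g n
total-cong zero    h = refl
total-cong (suc n) h = cong₂ _+_ (h 0 (s≤s z≤n)) (total-cong n λ x x<n → h (suc x) (s≤s x<n))

total-mono : ∀ {f g} n → (∀ x → x < n → f x ≤ g x) → total f n ≤ total g n
total-mono zero    h = z≤n
total-mono (suc n) h = +-mono-≤ (h 0 (s≤s z≤n)) (total-mono n λ x x<n → h (suc x) (s≤s x<n))

total-split : ∀ f a b → total f (a + b) ≡ total f a + total (λ x → f (a + x)) b
total-split f zero    b = refl
total-split f (suc a) b = trans (cong (f 0 +_) (total-split (f ∘ suc) a b)) (sym (+-assoc (f 0) _ _))

total-last : ∀ f n → total f (suc n) ≡ total f n + f n
total-last f zero    = +-comm (f 0) 0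
total-last f (suc n) = trans (cong (f 0 +_) (total-last (f ∘ suc) n)) (sym (+-assoc (f 0) _ _))

spt≤total : ∀ f n → spt f n ≤ total f n
spt≤total f n = total-mono n λ x _ → occ≤ (f x)

total-upd : ∀ (h : ℕ → ℕ) f {i} a {n} → i < n → total (h ∘ upd f i a) n + h (f i) ≡ total (h ∘ f) n + h a
total-upd h f {zero}  a {suc n} _       = swap (h a) (h (f 0)) _
  where
  swap : ∀ x y z → x + z + y ≡ y + z + x
  swap = solve-∀
total-upd h f {suc i} a {suc n} (s≤s i<n) =
  trans (+-assoc (h (f 0)) _ _) (trans (cong (h (f 0) +_) (total-upd h (f ∘ suc) a i<n)) (sym (+-assoc (h (f 0)) _ _)))

term≤total : ∀ f {i n} → i < n → f i ≤ total f n
term≤total f {zero}  {suc n} _         = m≤m+n (f 0) _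
term≤total f {suc i} {suc n} (s≤s i<n) = ≤-trans (term≤total (f ∘ suc) i<n) (m≤n+m _ (f 0))

search : ∀ f n → (∃[ i ] (i < n × 0 < f i)) ⊎ (∀ i → i < n → f i ≡ 0)
search f zero = inj₂ λ _ ()
search f (suc n) with f 0 in eq | search (f ∘ suc) n
... | suc a | _                     = inj₁ (0 , s≤s z≤n , ≤-trans (s≤s z≤n) (≤-reflexive (sym eq)))
... | zero  | inj₁ (i , i<n , 0<fi) = inj₁ (suc i , s≤s i<n , 0<fi)
... | zero  | inj₂ none             = inj₂ λ { zero _ → eq ; (suc i) (s≤s i<n) → none i i<n }

total≡0 : ∀ f n → (∀ i → i < n → f i ≡ 0) → total f n ≡ 0
total≡0 f zero    h = refl
total≡0 f (suc n) h = cong₂ _+_ (h 0 (s≤s z≤n)) (total≡0 (f ∘ suc) n λ i i<n → h (suc i) (s≤s i<n))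

positive-term : ∀ f n → 0 < total f n → ∃[ i ] (i < n × 0 < f i)
positive-term f n 0<Σ with search f n
... | inj₁ r    = r
... | inj₂ none = contradiction (total≡0 f n none) (>⇒≢ 0<Σ)

total-cut : ∀ q f n → total (cut q f) n ≤ total f (suc q)
total-cut q       f zero    = z≤n
total-cut zero    f (suc n) = ≤-reflexive (cong (f 0 +_) (total≡0 _ n λ _ _ → refl))
total-cut (suc q) f (suc n) = +-monoʳ-≤ (f 0) (total-cut q (f ∘ suc) n)

total-reverse : ∀ f m → total (λ x → f (m ∸ x)) (suc m) ≡ total f (suc m)
total-reverse f zero    = refl
total-reverse f (suc m) =
  trans (cong (f (suc m) +_) (total-reverse f m))
    (trans (+-comm (f (suc m)) _) (sym (total-last f (suc m))))

-- Greedy from the left: `g` takes whole entries until it holds `a`, and only the entry at which it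
-- fills up is shared with `h`.
total-divide : ∀ f n a b → a + b ≤ total f n →
  ∃[ g ] ∃[ h ] ((∀ x → g x + h x ≤ f x) × a ≤ total g n × b ≤ total h n)
total-divide f zero a b le = (λ _ → 0) , (λ _ → 0) , (λ _ → z≤n) , m+n≤o⇒m≤o a le , m+n≤o⇒n≤o a le
total-divide f (suc n) a b le with a ≤? f 0
... | yes a≤f0 = cons a (λ _ → 0) , cons (f 0 ∸ a) (f ∘ suc)
  , (λ { zero → ≤-reflexive (m+[n∸m]≡n a≤f0) ; (suc x) → ≤-refl })
  , m≤m+n a _
  , +-cancelˡ-≤ a b _ (≤-trans le (≤-reflexive (trans (cong (_+ total (f ∘ suc) n) (sym (m+[n∸m]≡n a≤f0))) (+-assoc a _ _))))
... | no a≰f0 with total-divide (f ∘ suc) n (a ∸ f 0) b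
      (+-cancelˡ-≤ (f 0) _ _ (≤-trans (≤-reflexive (trans (sym (+-assoc (f 0) _ b)) (cong (_+ b) (m+[n∸m]≡n (<⇒≤ (≰⇒> a≰f0)))))) le))
... | g , h , g+h≤f , a≤g , b≤h = cons (f 0) g , cons 0 h
  , (λ { zero → ≤-reflexive (+-identityʳ (f 0)) ; (suc x) → g+h≤f x })
  , ≤-trans (≤-reflexive (sym (m+[n∸m]≡n (<⇒≤ (≰⇒> a≰f0))))) (+-monoʳ-≤ (f 0) a≤g)
  , b≤h

-- Pebbling on an interval of positions

module _ {k : ℕ} where

  Near : ℕ → ℕ → Set
  Near i j = 1 ≤ ∣ i - j ∣ × ∣ i - j ∣ ≤ k

  -- Positions above m are junk: C and D are only constrained on 0..m.
  data Reach (m : ℕ) : ℕ → (ℕ → ℕ) → (ℕ → ℕ) → Set where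
    stop : ∀ {C D} → (∀ x → x ≤ m → D x ≤ C x) → Reach m 0 C D
    step : ∀ {c C C₀ D} i j → i ≤ m → j ≤ m → Near i j →
           -- `C₀` is any remainder once two pebbles are taken from `i`: no truncated subtraction
           -- occurs, and surplus pebbles may be dropped at every step.
           (∀ x → x ≤ m → C₀ x + pile i 2 x ≤ C x) →
           Reach m c (C₀ ⊕ pile j 1) D → Reach m (suc c) C D

  mono : ∀ {m c C C' D D'} → (∀ x → x ≤ m → C x ≤ C' x) → (∀ x → x ≤ m → D' x ≤ D x) →
         Reach m c C D → Reach m c C' D'
  mono C≤C' D'≤D (stop D≤C) = stop λ x x≤m → ≤-trans (D'≤D x x≤m) (≤-trans (D≤C x x≤m) (C≤C' x x≤m))
  mono C≤C' D'≤D (step i j i≤m j≤m near C₀≤C r) =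
    step i j i≤m j≤m near (λ x x≤m → ≤-trans (C₀≤C x x≤m) (C≤C' x x≤m)) (mono (λ _ _ → ≤-refl) D'≤D r)

  chain : ∀ {m c c' C D E} → Reach m c C D → Reach m c' D E → Reach m (c + c') C E
  chain (stop D≤C)                       r' = mono D≤C (λ _ _ → ≤-refl) r'
  chain (step i j i≤m j≤m near C₀≤C r)   r' = step i j i≤m j≤m near C₀≤C (chain r r')

  frame : ∀ {m c C D} E → Reach m c C D → Reach m c (C ⊕ E) (D ⊕ E)
  frame E (stop D≤C) = stop λ x x≤m → +-monoˡ-≤ (E x) (D≤C x x≤m)
  frame E (step {C₀ = C₀} i j i≤m j≤m near C₀≤C r) =
    step {C₀ = C₀ ⊕ E} i j i≤m j≤m near
      (λ x x≤m → ≤-trans (≤-reflexive (swap (C₀ x) (E x) _)) (+-monoˡ-≤ (E x) (C₀≤C x x≤m)))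
      (mono (λ x _ → ≤-reflexive (swap (C₀ x) _ (E x))) (λ _ _ → ≤-refl) (frame E r))
    where
    swap : ∀ a b c → a + b + c ≡ a + c + b
    swap = solve-∀

  both : ∀ {m c c' C C' D D'} → Reach m c C D → Reach m c' C' D' → Reach m (c + c') (C ⊕ C') (D ⊕ D')
  both {C' = C'} {D = D} {D' = D'} r r' =
    chain (frame C' r) (mono (λ x _ → ≤-reflexive (+-comm _ (D x))) (λ x _ → ≤-reflexive (+-comm (D x) (D' x))) (frame D r'))

  carry : ∀ {m i j} a → i ≤ m → j ≤ m → Near i j → Reach m a (pile i (a + a)) (pile j a)
  carry {j = j} zero i≤m j≤m near = stop λ x _ → ≤-trans (≤-reflexive (pile-0 j x)) z≤n
  carry {i = i} {j} (suc a) i≤m j≤m near = step {C₀ = pile i (a + a)} i j i≤m j≤m near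
    (λ x _ → ≤-reflexive (trans (pile-+ i (a + a) 2 x) (cong (λ b → pile i b x) (double a))))
    (mono (λ _ _ → ≤-refl) (λ x _ → ≤-reflexive (trans (cong (λ b → pile j b x) (+-comm 1 a)) (sym (pile-+ j a 1 x))))
      (frame (pile j 1) (carry a i≤m j≤m near)))
    where
    double : ∀ a → a + a + 2 ≡ suc a + suc a
    double = solve-∀

  extend : ∀ {m c C C' D D'} → (∀ x → x ≤ m → C' x ≤ C (suc x)) → (∀ x → x ≤ m → D (suc x) ≤ D' x) → D 0 ≤ C 0 →
           Reach m c C' D' → Reach (suc m) c C D
  extend C'≤C D≤D' D0≤C0 (stop D'≤C') = stop λ
    { zero _ → D0≤C0
    ; (suc x) (s≤s x≤m) → ≤-trans (D≤D' x x≤m) (≤-trans (D'≤C' x x≤m) (C'≤C x x≤m)) }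
  extend {C = C} C'≤C D≤D' D0≤C0 (step {C₀ = C₀} i j i≤m j≤m near C₀≤C' r) =
    step {C₀ = cons (C 0) C₀} (suc i) (suc j) (s≤s i≤m) (s≤s j≤m) near
      (λ { zero _ → ≤-reflexive (+-identityʳ (C 0)) ; (suc x) (s≤s x≤m) → ≤-trans (C₀≤C' x x≤m) (C'≤C x x≤m) })
      (extend (λ _ _ → ≤-refl) D≤D' (≤-trans D0≤C0 (m≤m+n (C 0) 0)) r)

  shift-reach : ∀ {q c C D} p → Reach q c C D → Reach (p + q) c (shift p C) (shift p D)
  shift-reach zero    r = r
  shift-reach (suc p) r = extend (λ _ _ → ≤-refl) (λ _ _ → ≤-refl) z≤n (shift-reach p r)

  -- What is junk beyond `m` for the short path would count on the longer one; `cut` replaces it by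
  -- zero, so that the other pebbles of the longer path remain free for use in parallel.
  prefix : ∀ {m M c C D} → m ≤ M → Reach m c C D → Reach M c (cut m C) (cut m D)
  prefix {m} {C = C} {D} m≤M (stop D≤C) = stop λ x _ → cut-mono m D C D≤C x
    where
    cut-mono : ∀ m f g → (∀ x → x ≤ m → f x ≤ g x) → ∀ x → cut m f x ≤ cut m g x
    cut-mono zero    f g h zero    = h 0 z≤n
    cut-mono zero    f g h (suc x) = z≤n
    cut-mono (suc m) f g h zero    = h 0 z≤n
    cut-mono (suc m) f g h (suc x) = cut-mono m (f ∘ suc) (g ∘ suc) (λ y y≤m → h (suc y) (s≤s y≤m)) x
  prefix {m} {C = C} m≤M (step {C₀ = C₀} i j i≤m j≤m near C₀≤C r) =
    step {C₀ = cut m C₀} i j (≤-trans i≤m m≤M) (≤-trans j≤m m≤M) near below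
      (mono above (λ _ _ → ≤-refl) (prefix m≤M r))
    where
    below : ∀ x → x ≤ _ → cut m C₀ x + pile i 2 x ≤ cut m C x
    below x _ with x ≤? m
    ... | yes x≤m rewrite cut-≤ m C₀ x x≤m | cut-≤ m C x x≤m = C₀≤C x x≤m
    ... | no  x≰m rewrite cut-> m C₀ x (≰⇒> x≰m) | cut-> m C x (≰⇒> x≰m) =
      ≤-reflexive (pile-≢ {i} {x} 2 (λ { refl → x≰m i≤m }))
    above : ∀ x → x ≤ _ → cut m (C₀ ⊕ pile j 1) x ≤ (cut m C₀ ⊕ pile j 1) x
    above x _ with x ≤? m
    ... | yes x≤m rewrite cut-≤ m C₀ x x≤m | cut-≤ m (C₀ ⊕ pile j 1) x x≤m = ≤-refl
    ... | no  x≰m rewrite cut-> m (C₀ ⊕ pile j 1) x (≰⇒> x≰m) = z≤n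

  reverse-near : ∀ {m i j} → i ≤ m → j ≤ m → Near i j → Near (m ∸ i) (m ∸ j)
  reverse-near {m} {i} {j} i≤m j≤m near = subst (λ d → 1 ≤ d × d ≤ k) (sym flip) near
    where
    flip : ∣ m ∸ i - m ∸ j ∣ ≡ ∣ i - j ∣
    flip = trans (sym (∣m+n-m+o∣≡∣n-o∣ (i + j) (m ∸ i) (m ∸ j)))
      (trans (cong₂ ∣_-_∣ (trans (swap i j (m ∸ i)) (cong (j +_) (m+[n∸m]≡n i≤m)))
                          (trans (+-assoc i j (m ∸ j)) (cong (i +_) (m+[n∸m]≡n j≤m))))
        (trans (cong₂ ∣_-_∣ (+-comm j m) (+-comm i m)) (trans (∣m+n-m+o∣≡∣n-o∣ m j i) (∣-∣-comm j i))))
      where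
      swap : ∀ a b c → a + b + c ≡ b + (a + c)
      swap = solve-∀

  pile-reverse : ∀ {m i x} a → i ≤ m → x ≤ m → pile (m ∸ i) a x ≡ pile i a (m ∸ x)
  pile-reverse {m} {i} {x} a i≤m x≤m with i ≟ m ∸ x
  ... | yes refl = trans (trans (cong (λ y → pile y a x) (m∸[m∸n]≡n x≤m)) (pile-self x a)) (sym (pile-self (m ∸ x) a))
  ... | no  i≢   = trans (pile-≢ {m ∸ i} {x} a λ m∸i≡x → i≢ (trans (sym (m∸[m∸n]≡n i≤m)) (cong (m ∸_) m∸i≡x))) (sym (pile-≢ {i} {m ∸ x} a i≢))

  reverse : ∀ {m c C D} → Reach m c C D → Reach m c (λ x → C (m ∸ x)) (λ x → D (m ∸ x))
  reverse {m} (stop D≤C) = stop λ x x≤m → D≤C (m ∸ x) (m∸n≤m m x)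
  reverse {m} (step {C₀ = C₀} i j i≤m j≤m near C₀≤C r) =
    step {C₀ = λ x → C₀ (m ∸ x)} (m ∸ i) (m ∸ j) (m∸n≤m m i) (m∸n≤m m j) (reverse-near i≤m j≤m near)
      (λ x x≤m → ≤-trans (≤-reflexive (cong (C₀ (m ∸ x) +_) (pile-reverse 2 i≤m x≤m))) (C₀≤C (m ∸ x) (m∸n≤m m x)))
      (mono (λ x x≤m → ≤-reflexive (cong (C₀ (m ∸ x) +_) (sym (pile-reverse 1 j≤m x≤m)))) (λ _ _ → ≤-refl) (reverse r))

  unreverse : ∀ {m c C D} → Reach m c (λ x → C (m ∸ x)) (λ x → D (m ∸ x)) → Reach m c C D
  unreverse {m} {C = C} {D} r = mono (λ x x≤m → ≤-reflexive (cong C (m∸[m∸n]≡n x≤m)))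
    (λ x x≤m → ≤-reflexive (cong D (sym (m∸[m∸n]≡n x≤m)))) (reverse r)

  Solves : ℕ → (ℕ → ℕ) → (ℕ → ℕ) → Set
  Solves m C D = ∃[ c ] Reach m c C D

-- The induction

module _ (k' : ℕ) where

  private
    k : ℕ
    k = suc k'

  -- Positions 0..m are n = m + 1 vertices, so `pred m` is n - 2 (and 0 for a single vertex). `X`
  -- stands for |C| + s(D), and `ℓ` is a reserve for support that will be lost when targets merge.
  record Good (m t ℓ X : ℕ) : Set where
    constructor mkGood
    field bound : ∀ e → k * e ≤ pred m → t * 2 ^ suc e + m + ℓ ≤ X + k * e
  open Good

  good? : ∀ m t ℓ X → Good m t ℓ X ⊎ (∃[ e ] (k * e ≤ pred m × X + k * e < t * 2 ^ suc e + m + ℓ))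
  -- As k is positive, k e ≤ `pred m` bounds `e` by `m`, so this finite search is exhaustive.
  good? m t ℓ X with anyUpTo? (λ e → (k * e ≤? pred m) ×-dec (X + k * e <? t * 2 ^ suc e + m + ℓ)) (suc m)
  ... | yes (e , _ , bad) = inj₂ (e , bad)
  ... | no  none          = inj₁ (mkGood λ e ke≤ → ≮⇒≥ λ lt →
    none (e , s≤s (≤-trans (m≤m+n e (k' * e)) (≤-trans ke≤ pred[n]≤n)) , ke≤ , lt))

  -- Each of the `a` dropped demands releases 2^(e+1) ≥ 2 in every term and so pays for two units of
  -- `X`; `b` further units come from lowering `m + ℓ`. A smaller `m` only shortens the range of
  -- `e`.
  good-weaken : ∀ {m t ℓ X m' t' ℓ' X'} a b → t' + a ≤ t → X ≤ X' + 2 * a + b → m' + ℓ' + b ≤ m + ℓ → m' ≤ m →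
                Good m t ℓ X → Good m' t' ℓ' X'
  good-weaken {m} {t} {ℓ} {X} {m'} {t'} {ℓ'} {X'} a b t'≤t X≤X' m'≤m p good .bound e ke≤ =
    linear 0 (*-monoˡ-≤ y t'≤t ⟨+⟩ *-monoʳ-≤ a 2≤y ⟨+⟩ m'≤m ⟨+⟩ bound good e (≤-trans ke≤ (pred-mono-≤ p)) ⟨+⟩ X≤X')
      (arith t t' a b y m ℓ m' ℓ' X X' (k * e))
    where
    y = 2 ^ suc e
    2≤y : 2 ≤ y
    2≤y = *-monoʳ-≤ 2 (m^n>0 2 e)
    arith : ∀ t t' a b y m ℓ m' ℓ' X X' K →
      t' * y + m' + ℓ' + (t * y + a * y + (m + ℓ) + (X + K) + (X' + 2 * a + b)) + 0 ≡
      X' + K + ((t' + a) * y + a * 2 + (m' + ℓ' + b) + (t * y + m + ℓ) + X)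
    arith = solve-∀

  -- The term `e = 0` and s(D) ≤ |D| together leave at least |D| pebbles.
  good⇒pebbled : ∀ {m ℓ} C D n → 0 < total D n → Good m (total D n) ℓ (C + spt D n) → 0 < C
  good⇒pebbled {m} {ℓ} C D n 0<D good = linear 0 (0<D ⟨+⟩ spt≤total D n ⟨+⟩ bound good 0 (≤-trans (≤-reflexive (*-zeroʳ k)) z≤n) ⟨+⟩ z≤n {m + ℓ})
    (trans (cong (λ z → 1 + (total D n + total D n + (C + spt D n + z) + (m + ℓ)) + 0) (*-zeroʳ k)) (arith C (total D n) (spt D n) m ℓ))
    where
    arith : ∀ C t s m ℓ → 1 + (t + t + (C + s + 0) + (m + ℓ)) + 0 ≡ C + (1 + s + (t * 2 + m + ℓ) + 0)
    arith = solve-∀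

  -- Deleting position 0: its D 0 pebbles are to come from r, where b pebbles of C are set aside.
  absorb : ∀ {m C D C' D'} r b → r ≤ m → r < k →
           (∀ x → x ≤ m → C' x + pile r b x ≤ C (suc x)) →
           (∀ x → x ≤ m → D (suc x) + pile r (D 0 + D 0) x ≤ D' x + pile r b x) →
           Solves {k} m C' D' → Solves {k} (suc m) C D
  absorb {m} {C} {D} r b r≤m r<k C'≤C D≤D' (c , reach) = _ , chain
    (extend {D = cons 0 ((D ∘ suc) ⊕ pile r (D 0 + D 0))} (λ _ _ → ≤-refl) (λ _ _ → ≤-refl) z≤n
      (mono C'≤C D≤D' (frame (pile r b) reach)))
    (mono (λ { zero _ → z≤n ; (suc x) _ → ≤-reflexive (+-comm (pile r (D 0 + D 0) x) (D (suc x))) })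
          (λ { zero _ → m≤m+n (D 0) 0 ; (suc x) _ → ≤-refl })
      (frame (cons 0 (D ∘ suc)) (carry {i = suc r} {j = 0} (D 0) (s≤s r≤m) z≤n (s≤s z≤n , r<k))))

  -- Moving the targets of the first k positions inward

  module Shift (m' N : ℕ)
    (solve : ∀ C D → m' + total C (suc m') < N →
             Good m' (total D (suc m')) 0 (total C (suc m') + spt D (suc m')) → Solves {k} m' C D)
    where

    -- The first j positions are cleared one by one, each D 0 being replaced by a demand within reach,
    -- hence at most doubled.  L bounds the loss of support when 0 and k are both targets.
    clear : ∀ j C D L → j ≤ k → (∀ x → x < j → C x ≡ 0) →
            (∀ x → x < j → k + x ≤ j + m' → occ (D (k + x)) ≤ L x) →
            m' + total C (suc (j + m')) < N →
            -- Demands before `j` count twice. Each is doubled at most once, because its replacement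
            -- lands outside the positions still to be cleared.
            Good m' (total D (suc (j + m')) + total D j) (total L j) (total C (suc (j + m')) + spt D (suc (j + m'))) →
            Solves {k} (j + m') C D
    clear zero C D L j≤k C≡0 loss C<N good =
      solve C D C<N (good-weaken 0 0 ≤-refl (≤-trans (m≤m+n _ 0) (m≤m+n _ 0)) (≤-reflexive (+-identityʳ _)) ≤-refl good)
    clear (suc j) C D L j<k C≡0 loss C<N good = by-demand (D 0) refl
      where
      n = j + m'
      Ct Dt : ℕ → ℕ
      Ct = C ∘ suc
      Dt = D ∘ suc
      Ct<N : m' + total Ct (suc n) < N
      Ct<N = ≤-<-trans (+-monoʳ-≤ m' (m≤n+m _ (C 0))) C<N

      -- The target lost at 0 is regained at position k (which is `r` after the deletion), unless
      -- that was a target already; then `L 0` pays.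
      hub : ∀ r → r ≤ n → r < k → suc r ≡ k → 0 < D 0 → Solves {k} (suc n) C D
      hub r r≤n r<k refl 0<D0 = absorb r 0 r≤n r<k
          (λ x _ → ≤-reflexive (trans (cong (Ct x +_) (pile-0 r x)) (+-identityʳ (Ct x))))
          (λ x _ → ≤-upd-pile Dt r x (≤-reflexive (sym (+-identityʳ _))))
          (clear j Ct D' (L ∘ suc) (<⇒≤ j<k) (λ x x<j → C≡0 (suc x) (s≤s x<j))
            (λ x x<j k+x≤ → ≤-trans
              (≤-reflexive (cong occ (trans (upd-≢ Dt {r} {k + x} _ (<⇒≢ (m≤m+n (suc r) x))) (cong D (sym (+-suc k x))))))
              (loss (suc x) (s≤s x<j) (≤-trans (≤-reflexive (+-suc k x)) (s≤s k+x≤))))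
            Ct<N
            (good-weaken 0 (occ (Dt r)) demand budget (≤-trans (≤-reflexive (swap m' _ (occ (Dt r)))) (+-monoʳ-≤ m' (+-monoˡ-≤ _ hub-loss))) ≤-refl good))
        where
        D' = upd Dt r (Dt r + (D 0 + D 0))
        swap : ∀ a b c → a + b + c ≡ a + (c + b)
        swap = solve-∀
        hub-loss : occ (Dt r) ≤ L 0
        hub-loss = ≤-trans (≤-reflexive (cong (occ ∘ D) (sym (+-identityʳ k)))) (loss 0 (s≤s z≤n) (≤-trans (≤-reflexive (+-identityʳ k)) (s≤s r≤n)))
        demand : total D' (suc n) + total D' j + 0 ≤ D 0 + total Dt (suc n) + (D 0 + total Dt j)
        demand = linear 0 (≤-reflexive (total-upd id Dt (Dt r + (D 0 + D 0)) (s≤s r≤n)) ⟨+⟩ ≤-reflexive (total-cong j λ x x<j → upd-≢ Dt (Dt r + (D 0 + D 0)) (>⇒≢ (<-≤-trans x<j (≤-pred j<k)))))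
          (arith (total D' (suc n)) (total D' j) (D 0) (total Dt (suc n)) (total Dt j) (Dt r))
          where
          arith : ∀ T' S' a T S d → T' + S' + 0 + (T + (d + (a + a)) + S) + 0 ≡ a + T + (a + S) + (T' + d + S')
          arith = solve-∀
        budget : C 0 + total Ct (suc n) + (occ (D 0) + spt Dt (suc n)) ≤ total Ct (suc n) + spt D' (suc n) + 0 + occ (Dt r)
        budget = linear 0 (≤-reflexive (C≡0 0 (s≤s z≤n)) ⟨+⟩ occ≤1 (D 0) ⟨+⟩ ≤-reflexive (sym (total-upd occ Dt _ (s≤s r≤n)))
            ⟨+⟩ ≤-reflexive (sym (occ-pos {Dt r + (D 0 + D 0)} (<-≤-trans 0<D0 (≤-trans (m≤m+n (D 0) (D 0)) (m≤n+m _ (Dt r)))))))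
          (arith (C 0) (total Ct (suc n)) (occ (D 0)) (spt Dt (suc n)) (spt D' (suc n)) (occ (Dt r)) (occ (Dt r + (D 0 + D 0))))
          where
          arith : ∀ c Σ o s s' p q → c + Σ + (o + s) + (0 + 1 + (s' + p) + q) + 0 ≡ Σ + s' + 0 + p + (c + o + (s + q) + 1)
          arith = solve-∀

      -- The pebble on `r` saves one of the 2 D 0 new demands. That demand is worth two units, which
      -- pay for the pebble and for the target lost at 0, so `L 0` is not drawn upon.
      borrow : 0 < D 0 → ∀ r → r ≤ n → r < k → j ≤ r → (k ≤ suc n → suc r ≡ k) → 0 < Ct r → Solves {k} (suc n) C D
      borrow 0<D0 r r≤n r<k j≤r at-hub 0<Cr = absorb r 1 r≤n r<k
          (λ x _ → upd-pile-≤ Ct r x (≤-reflexive (m∸n+n≡m 0<Cr)))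
          (λ x _ → ≤-upd-pile Dt r x (≤-reflexive (sym rest)))
          (clear j C' D' (L ∘ suc) (<⇒≤ j<k)
            (λ x x<j → trans (upd-≢ Ct _ (>⇒≢ (<-≤-trans x<j j≤r))) (C≡0 (suc x) (s≤s x<j)))
            (λ x x<j k+x≤ → ≤-trans
              (≤-reflexive (cong occ (trans (upd-≢ Dt {r} {k + x} _ (<⇒≢ (≤-trans (≤-reflexive (at-hub (≤-trans (m≤m+n k x) (m≤n⇒m≤1+n k+x≤)))) (m≤m+n k x)))) (cong D (sym (+-suc k x))))))
              (loss (suc x) (s≤s x<j) (≤-trans (≤-reflexive (+-suc k x)) (s≤s k+x≤))))
            (≤-<-trans (+-monoʳ-≤ m' (≤-trans (m≤m+n _ 1) (≤-reflexive pebbles))) Ct<N)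
            (good-weaken 1 0 demand budget (≤-trans (≤-reflexive (+-identityʳ _)) (+-monoʳ-≤ m' (m≤n+m _ (L 0)))) ≤-refl good))
        where
        C' = upd Ct r (Ct r ∸ 1)
        D' = upd Dt r (Dt r + (D 0 + D 0 ∸ 1))
        rest : Dt r + (D 0 + D 0 ∸ 1) + 1 ≡ Dt r + (D 0 + D 0)
        rest = trans (+-assoc (Dt r) _ 1) (cong (Dt r +_) (m∸n+n≡m (≤-trans 0<D0 (m≤m+n (D 0) (D 0)))))
        pebbles : total C' (suc n) + 1 ≡ total Ct (suc n)
        pebbles = +-cancelʳ-≡ (Ct r ∸ 1) _ _ (trans (+-assoc _ 1 _)
          (trans (cong (total C' (suc n) +_) (m+[n∸m]≡n 0<Cr)) (total-upd id Ct (Ct r ∸ 1) (s≤s r≤n))))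
        demand : total D' (suc n) + total D' j + 1 ≤ D 0 + total Dt (suc n) + (D 0 + total Dt j)
        demand = linear 0 (≤-reflexive (total-upd id Dt (Dt r + (D 0 + D 0 ∸ 1)) (s≤s r≤n)) ⟨+⟩ ≤-reflexive (total-cong j λ x x<j → upd-≢ Dt (Dt r + (D 0 + D 0 ∸ 1)) (>⇒≢ (<-≤-trans x<j j≤r))) ⟨+⟩ ≤-reflexive rest)
          (arith (total D' (suc n)) (total D' j) (D 0) (total Dt (suc n)) (total Dt j) (Dt r) (Dt r + (D 0 + D 0 ∸ 1)))
          where
          arith : ∀ T' S' a T S d v → T' + S' + 1 + (T + v + S + (d + (a + a))) + 0 ≡ a + T + (a + S) + (T' + d + S' + (v + 1))
          arith = solve-∀
        budget : C 0 + total Ct (suc n) + (occ (D 0) + spt Dt (suc n)) ≤ total C' (suc n) + spt D' (suc n) + 2 * 1 + 0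
        budget = linear 0 (≤-reflexive (C≡0 0 (s≤s z≤n)) ⟨+⟩ occ≤1 (D 0) ⟨+⟩ ≤-reflexive (sym pebbles) ⟨+⟩ same-support)
          (arith (C 0) (total Ct (suc n)) (total C' (suc n)) (occ (D 0)) (spt Dt (suc n)) (spt D' (suc n)))
          where
          same-support : spt Dt (suc n) ≤ spt D' (suc n)
          same-support = total-mono (suc n) λ x _ → occ-mono (≤-upd Dt r x (m≤m+n (Dt r) (D 0 + D 0 ∸ 1)))
          arith : ∀ c Σ Σ' o s s' → c + Σ + (o + s) + (0 + 1 + (Σ' + 1) + s') + 0 ≡ Σ' + s' + 2 * 1 + 0 + (c + o + Σ + s)
          arith = solve-∀

      replace : 0 < D 0 → Solves {k} (suc n) C D
      replace 0<D0 with k ≤? suc n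
      ... | yes (s≤s k'≤n) = at-k (Ct k') refl
        where
        at-k : ∀ c → Ct k' ≡ c → Solves {k} (suc n) C D
        at-k zero    C≡ = hub k' k'≤n ≤-refl refl 0<D0
        at-k (suc c) C≡ = borrow 0<D0 k' k'≤n ≤-refl (≤-pred j<k) (λ _ → refl) (≤-trans (s≤s z≤n) (≤-reflexive (sym C≡)))
      -- Position k has fallen off the path: all remaining positions are within reach of 0, and any
      -- pebbled one will do.
      ... | no k≰ with positive-term Ct (suc n) pebbled
        where
        pebbled : 0 < total Ct (suc n)
        pebbled = subst (λ c → 0 < c + total Ct (suc n)) (C≡0 0 (s≤s z≤n))
          (good⇒pebbled {m'} {total L (suc j)} (total C (suc (suc n))) D (suc (suc n)) (≤-trans 0<D0 (m≤m+n (D 0) _))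
            (good-weaken 0 0 (≤-trans (≤-reflexive (+-identityʳ _)) (m≤m+n _ _)) (≤-trans (m≤m+n _ 0) (m≤m+n _ 0)) (≤-reflexive (+-identityʳ _)) ≤-refl good))
      ... | r , s≤s r≤n , 0<Cr = borrow 0<D0 r r≤n (≤-trans (s≤s r≤n) (<⇒≤ (≰⇒> k≰)))
          (≮⇒≥ λ r<j → >⇒≢ 0<Cr (C≡0 (suc r) (s≤s r<j))) (λ k≤ → contradiction k≤ k≰) 0<Cr

      by-demand : ∀ a → D 0 ≡ a → Solves {k} (suc n) C D
      by-demand (suc a) D0≡ = replace (≤-trans (s≤s z≤n) (≤-reflexive (sym D0≡)))
      by-demand zero    D0≡ with clear j Ct Dt (L ∘ suc) (<⇒≤ j<k) (λ x x<j → C≡0 (suc x) (s≤s x<j))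
            (λ x x<j k+x≤ → ≤-trans (≤-reflexive (cong (occ ∘ D) (sym (+-suc k x)))) (loss (suc x) (s≤s x<j) (≤-trans (≤-reflexive (+-suc k x)) (s≤s k+x≤))))
            Ct<N
            (good-weaken 0 0 (linear {c = 0} (D 0 + D 0) z≤n (demand (total Dt (suc n)) (total Dt j) (D 0)))
              (linear 0 (≤-reflexive (C≡0 0 (s≤s z≤n)) ⟨+⟩ ≤-reflexive (cong occ D0≡)) (budget (C 0) (total Ct (suc n)) (occ (D 0)) (spt Dt (suc n))))
              (≤-trans (≤-reflexive (+-identityʳ _)) (+-monoʳ-≤ m' (m≤n+m _ (L 0)))) ≤-refl good)
        where
        demand : ∀ T S a → T + S + 0 + 0 + (a + a) ≡ a + T + (a + S) + 0
        demand = solve-∀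
        budget : ∀ c Σ o s → c + Σ + (o + s) + 0 + 0 ≡ Σ + s + 2 * 0 + 0 + (c + o)
        budget = solve-∀
      ... | c , reach = c , extend (λ _ _ → ≤-refl) (λ _ _ → ≤-refl) (≤-trans (≤-reflexive D0≡) z≤n) reach

  Below : ℕ → Set
  Below M = ∀ m C D → m + total C (suc m) < M →
            Good m (total D (suc m)) 0 (total C (suc m) + spt D (suc m)) → Solves {k} m C D

  private
    remove-one : ∀ C {r n} → r < n → 0 < C r → total (upd C r (C r ∸ 1)) n + 1 ≡ total C n
    remove-one C {r} {n} r<n 0<Cr = +-cancelʳ-≡ (C r ∸ 1) _ _ (trans (+-assoc _ 1 _)
      (trans (cong (total (upd C r (C r ∸ 1)) n +_) (m+[n∸m]≡n 0<Cr)) (total-upd id C (C r ∸ 1) r<n)))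

  -- Targets that carry a pebble, and targets at an end

  -- The dropped demand releases two units in every term: one for the pebble that meets it, one for
  -- the support that may vanish.
  met-target : ∀ m C D r → r ≤ m → 0 < C r → 0 < D r → Below (m + total C (suc m)) →
               Good m (total D (suc m)) 0 (total C (suc m) + spt D (suc m)) → Solves {k} m C D
  met-target m C D r r≤m 0<Cr 0<Dr ih good
    with ih m (upd C r (C r ∸ 1)) (upd D r (D r ∸ 1))
      (≤-trans (≤-reflexive (trans (sym (+-suc m _)) (cong (m +_) (+-comm 1 _)))) (≤-reflexive (cong (m +_) fewer-pebbles)))
      (good-weaken 1 0 (≤-reflexive (remove-one D (s≤s r≤m) 0<Dr)) budget (≤-reflexive (+-identityʳ _)) ≤-refl good)
    where
    C' = upd C r (C r ∸ 1)
    D' = upd D r (D r ∸ 1)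
    fewer-pebbles = remove-one C (s≤s r≤m) 0<Cr
    budget : total C (suc m) + spt D (suc m) ≤ total C' (suc m) + spt D' (suc m) + 2 * 1 + 0
    budget = linear (occ (D r ∸ 1)) (≤-reflexive (sym fewer-pebbles) ⟨+⟩ ≤-reflexive (sym (total-upd occ D (D r ∸ 1) (s≤s r≤m))) ⟨+⟩ occ≤1 (D r))
      (arith (total C (suc m)) (total C' (suc m)) (spt D (suc m)) (spt D' (suc m)) (occ (D r)) (occ (D r ∸ 1)))
      where
      arith : ∀ c c' s s' p q → c + s + (c' + 1 + (s' + p) + 1) + q ≡ c' + s' + 2 * 1 + 0 + (c + (s + q) + p)
      arith = solve-∀
  ... | c , reach = c , mono
    (λ x _ → upd-pile-≤ C r x (≤-reflexive (m∸n+n≡m 0<Cr)))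
    (λ x _ → ≤-trans (m≤m+n (D x) _) (≤-upd-pile D r {b = 0} x (≤-reflexive (trans (+-identityʳ _) (sym (m∸n+n≡m 0<Dr))))))
    (frame (pile r 1) reach)

  end-target : ∀ m C D → Below (m + total C (suc m)) → 0 < D 0 →
               Good m (total D (suc m)) 0 (total C (suc m) + spt D (suc m)) → Solves {k} m C D
  end-target m C D ih 0<D0 good = by-origin (C 0) refl
    where
    -- One of the two pebbles needed at r to reach 0 is already there.
    nearby : C 0 ≡ 0 → ∀ r → r ≤ m → r ≤ k → 0 < C r → D r ≡ 0 → Solves {k} m C D
    nearby C0≡0 zero    r≤m r≤k 0<Cr Dr≡0 = contradiction C0≡0 (>⇒≢ 0<Cr)
    nearby C0≡0 (suc r) (s≤s {n = n} r≤n) r<k 0<Cr Dr≡0 = by-multiplicity (D 0) refl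
      where
      Ct = C ∘ suc
      Dt = D ∘ suc
      C' = upd Ct r (Ct r ∸ 1)
      D' = upd Dt r 1
      fewer-pebbles : total C' (suc n) + 1 ≡ total Ct (suc n)
      fewer-pebbles = remove-one Ct (s≤s r≤n) 0<Cr
      C'≤C : ∀ x → C' x + pile r 1 x ≤ Ct x
      C'≤C x = upd-pile-≤ Ct r x (≤-reflexive (m∸n+n≡m 0<Cr))
      D≤D' : ∀ x → Dt x + pile r 2 x ≤ D' x + pile r 1 x
      D≤D' x = ≤-upd-pile Dt r x (≤-reflexive (cong (_+ 2) Dr≡0))
      more-demand : total D' (suc n) + 0 ≡ total Dt (suc n) + 1
      more-demand = trans (cong (total D' (suc n) +_) (sym Dr≡0)) (total-upd id Dt 1 (s≤s r≤n))
      more-support : spt D' (suc n) + 0 ≡ spt Dt (suc n) + 1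
      more-support = trans (cong ((spt D' (suc n) +_) ∘ occ) (sym Dr≡0)) (total-upd occ Dt 1 (s≤s r≤n))

      by-multiplicity : ∀ a → D 0 ≡ a → Solves {k} (suc n) C D
      by-multiplicity zero D0≡ = contradiction D0≡ (>⇒≢ 0<D0)
      by-multiplicity (suc zero) D0≡ = absorb r 1 r≤n r<k (λ x _ → C'≤C x)
        (λ x _ → ≤-trans (≤-reflexive (cong (λ a → Dt x + pile r (a + a) x) D0≡)) (D≤D' x))
        (ih n C' D' (s≤s (+-monoʳ-≤ n (≤-trans (m≤m+n _ 1) (≤-trans (≤-reflexive fewer-pebbles) (m≤n+m _ (C 0))))))
          -- The deleted vertex pays for the pebble set aside, and the target lost at 0 reappears at
          -- `r`.
          (good-weaken 0 1 (≤-reflexive (trans more-demand (trans (+-comm _ 1) (cong (_+ total Dt (suc n)) (sym D0≡))))) budget (≤-reflexive (arith₁ n)) (n≤1+n n) good))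
        where
        arith₁ : ∀ n → n + 0 + 1 ≡ suc n + 0
        arith₁ = solve-∀
        budget : C 0 + total Ct (suc n) + (occ (D 0) + spt Dt (suc n)) ≤ total C' (suc n) + spt D' (suc n) + 2 * 0 + 1
        budget = linear 0 (≤-reflexive C0≡0 ⟨+⟩ occ≤1 (D 0) ⟨+⟩ ≤-reflexive (sym more-support) ⟨+⟩ ≤-reflexive (sym fewer-pebbles))
          (arith (C 0) (total Ct (suc n)) (total C' (suc n)) (occ (D 0)) (spt Dt (suc n)) (spt D' (suc n)))
          where
          arith : ∀ c Σ Σ' o s s' → c + Σ + (o + s) + (0 + 1 + (s' + 0) + (Σ' + 1)) + 0 ≡ Σ' + s' + 2 * 0 + 1 + (c + o + (s + 1) + Σ)
          arith = solve-∀
      by-multiplicity (suc (suc a)) D0≡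
        with ih (suc n) (cons (C 0) C') (cons (suc a) D')
          (≤-reflexive (trans (sym (+-suc (suc n) _)) (cong (suc n +_) (trans (sym (+-suc (C 0) _)) (cong (C 0 +_) (trans (+-comm 1 _) fewer-pebbles))))))
          -- Here 0 remains a target, so `r` is an additional one, and this unit of support pays for
          -- the pebble.
          (good-weaken 0 0 demand budget (≤-reflexive (+-identityʳ _)) ≤-refl good)
        where
        demand : suc a + total D' (suc n) + 0 ≤ D 0 + total Dt (suc n)
        demand = linear 0 (≤-reflexive (sym D0≡) ⟨+⟩ ≤-reflexive more-demand) (arith a (total D' (suc n)) (total Dt (suc n)) (D 0))
          where
          arith : ∀ a T' T d → suc a + T' + 0 + (d + (T + 1)) + 0 ≡ d + T + (suc (suc a) + (T' + 0))
          arith = solve-∀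
        budget : C 0 + total Ct (suc n) + (occ (D 0) + spt Dt (suc n)) ≤ C 0 + total C' (suc n) + (1 + spt D' (suc n)) + 2 * 0 + 0
        budget = linear 0 (occ≤1 (D 0) ⟨+⟩ ≤-reflexive (sym more-support) ⟨+⟩ ≤-reflexive (sym fewer-pebbles))
          (arith (C 0) (total Ct (suc n)) (total C' (suc n)) (occ (D 0)) (spt Dt (suc n)) (spt D' (suc n)))
          where
          arith : ∀ c Σ Σ' o s s' → c + Σ + (o + s) + (1 + (s' + 0) + (Σ' + 1)) + 0 ≡ c + Σ' + (1 + s') + 2 * 0 + 0 + (o + (s + 1) + Σ)
          arith = solve-∀
      ... | c , reach = _ , chain
        (mono {D' = pile (suc r) 2 ⊕ cons (suc a) Dt} (λ { zero _ → ≤-reflexive (+-identityʳ (C 0)) ; (suc x) _ → C'≤C x })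
              (λ { zero _ → ≤-reflexive (+-comm 0 (suc a)) ; (suc x) _ → ≤-trans (≤-reflexive (+-comm (pile r 2 x) (Dt x))) (D≤D' x) })
          (frame (pile (suc r) 1) reach))
        (mono (λ _ _ → ≤-refl) (λ { zero _ → ≤-reflexive D0≡ ; (suc x) _ → ≤-refl })
          (frame (cons (suc a) Dt) (carry {i = suc r} {j = 0} 1 (s≤s r≤n) z≤n (s≤s z≤n , r<k))))

    pebbled-near : C 0 ≡ 0 → ∀ r → r ≤ m → r ≤ k → 0 < C r → Solves {k} m C D
    pebbled-near C0≡0 r r≤m r≤k 0<Cr with D r in Dr≡
    ... | zero  = nearby C0≡0 r r≤m r≤k 0<Cr Dr≡
    ... | suc _ = met-target m C D r r≤m 0<Cr (≤-trans (s≤s z≤n) (≤-reflexive (sym Dr≡))) ih good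

    pushed : ∀ q → k + suc q ≡ m → (∀ r → r < suc k → C r ≡ 0) → Solves {k} m C D
    pushed q refl none = Shift.clear q₁ (q₁ + total C (suc (k + q₁)) + 1) (λ C' D' lt → ih q₁ C' D' (≤-trans lt (later q (total C (suc (k + q₁))))))
        k C D L ≤-refl (λ r r<k → none r (m≤n⇒m≤1+n r<k))
        (λ x x<k k+x≤ → ≤-reflexive (sym (cut-≤ q₁ (λ y → occ (D (k + y))) x (+-cancelˡ-≤ k x q₁ k+x≤))))
        (≤-reflexive (+-comm 1 _))
        good'
      where
      q₁ = suc q
      -- Merging can occur only where `k + y` is a position of the path; beyond that `D` is junk.
      L = cut q₁ (λ y → occ (D (k + y)))
      later : ∀ q c → suc q + c + 1 ≤ k + suc q + c
      later q c = ≤-trans (≤-reflexive (+-comm _ 1)) (+-monoˡ-≤ c (s≤s (m≤n+m _ k')))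
      low = total D k
      high = total (λ y → D (k + y)) (suc q₁)
      loss≤high : total L k ≤ high
      loss≤high = ≤-trans (total-cut q₁ (λ y → occ (D (k + y))) k) (total-mono (suc q₁) λ x _ → occ≤ (D (k + x)))
      total-D : total D (suc (k + q₁)) ≡ low + high
      total-D = trans (cong (total D) (sym (+-suc k q₁))) (total-split D k (suc q₁))
      good' : Good q₁ (total D (suc (k + q₁)) + low) (total L k) (total C (suc (k + q₁)) + spt D (suc (k + q₁)))
      -- Term `e + 1` of the hypothesis, less k, becomes term `e`. As |D| = low + high, |D| 2^(e+2)
      -- exceeds (|D| + low) 2^(e+1) by high 2^(e+1), which covers `total L k`.
      good' .bound e ke≤ = linear 0
          (bound good (suc e) ke'≤ ⟨+⟩ loss≤high ⟨+⟩ high≤ ⟨+⟩ ≤-reflexive (cong (_* y) (sym total-D)) ⟨+⟩ ≤-reflexive (*-suc k e))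
          (arith (total D (suc (k + q₁))) low high (total L k) y (total C (suc (k + q₁)) + spt D (suc (k + q₁))) k q₁ (k * e) (k * suc e))
        where
        y = 2 ^ suc e
        arith : ∀ t a h ℓ y X k q ke ks →
          (t + a) * y + q + ℓ + (X + ks + h + h * y + t * y + (k + ke)) + 0 ≡
          X + ke + (t * (2 * y) + (k + q) + 0 + ℓ + h + (a + h) * y + ks)
        arith = solve-∀
        high≤ : high ≤ high * y
        high≤ = ≤-trans (≤-reflexive (sym (*-identityʳ high))) (*-monoʳ-≤ high (m^n>0 2 (suc e)))
        ke'≤ : k * suc e ≤ pred (k + q₁)
        ke'≤ = ≤-trans (≤-reflexive (*-suc k e)) (≤-trans (+-monoʳ-≤ k ke≤) (≤-reflexive (sym (+-suc k' q))))

    by-origin : ∀ c → C 0 ≡ c → Solves {k} m C D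
    by-origin (suc c) C0≡ = met-target m C D 0 z≤n (≤-trans (s≤s z≤n) (≤-reflexive (sym C0≡))) 0<D0 ih good
    by-origin zero    C0≡ with m ≤? k
    ... | yes m≤k with positive-term C (suc m) (good⇒pebbled (total C (suc m)) D (suc m) (≤-trans 0<D0 (m≤m+n (D 0) _)) good)
    ...   | r , s≤s r≤m , 0<Cr = pebbled-near C0≡ r r≤m (≤-trans r≤m m≤k) 0<Cr
    by-origin zero    C0≡ | no m≰k with search C (suc k)
    ...   | inj₁ (r , s≤s r≤k , 0<Cr) = pebbled-near C0≡ r (≤-trans r≤k (<⇒≤ (≰⇒> m≰k))) r≤k 0<Cr
    ...   | inj₂ none = pushed (m ∸ suc k) (trans (+-suc k _) (m+[n∸m]≡n (≰⇒> m≰k))) none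

  -- Inner targets: splitting the path

  -- (u + w − 1) x y + 1 ≥ u x + w y, doubled and with both sides moved so that no subtraction occurs.
  superadditive : ∀ u w x y → 1 ≤ u → 1 ≤ w → 1 ≤ x → 1 ≤ y → u * (2 * x) + w * (2 * y) + 2 * (x * y) ≤ (u + w) * (2 * (x * y)) + 2
  superadditive (suc u) (suc w) (suc x) (suc y) _ _ _ _ = linear {c = 0} (2 * (u * (suc x * y) + w * (suc y * x) + x * y)) z≤n (arith u w x y)
    where
    arith : ∀ u w x y →
      suc u * (2 * suc x) + suc w * (2 * suc y) + 2 * (suc x * suc y) + 0 + 2 * (u * (suc x * y) + w * (suc y * x) + x * y) ≡
      (suc u + suc w) * (2 * (suc x * suc y)) + 2 + 0
    arith = solve-∀

  -- The term `e` that fails on the left, taken from the term `e + e'` of the whole, leaves the term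
  -- `e'` on the right. Both `suc` arise at the split vertex: one of its demands, and its unit of
  -- support, enter both counts.
  good-remainder : ∀ {p q t X u w X₁ X₂ e} → 1 ≤ u → 1 ≤ w → u + w ≡ suc t → X₁ + X₂ ≡ suc X →
    k * e ≤ pred p → X₁ + k * e < u * 2 ^ suc e + p + 0 → Good (p + q) t 0 X → Good q w 0 X₂
  good-remainder {p} {q} {t} {X} {u} {w} {X₁} {X₂} {e} 1≤u 1≤w u+w≡ X₁+X₂≡ ke≤ bad good .bound e' ke'≤ =
    linear 0 (bad ⟨+⟩ bound good (e + e') fits ⟨+⟩ superadditive u w x y 1≤u 1≤w (m^n>0 2 e) (m^n>0 2 e')
        ⟨+⟩ ≤-reflexive (cong (_* (2 * (x * y))) u+w≡) ⟨+⟩ ≤-reflexive (sym X₁+X₂≡)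
        ⟨+⟩ ≤-reflexive (*-distribˡ-+ k e e') ⟨+⟩ ≤-reflexive (cong (λ z → t * (2 * z)) (sym (^-distribˡ-+-* 2 e e'))))
      (arith u w x y p q t X X₁ X₂ (k * e) (k * e') (k * (e + e')) (2 ^ (e + e')))
    where
    x = 2 ^ e
    y = 2 ^ e'
    pred-+ : ∀ p q → pred p + pred q ≤ pred (p + q)
    pred-+ zero    q = ≤-refl
    pred-+ (suc p) q = +-monoʳ-≤ p pred[n]≤n
    fits : k * (e + e') ≤ pred (p + q)
    fits = ≤-trans (≤-reflexive (*-distribˡ-+ k e e')) (≤-trans (+-mono-≤ ke≤ ke'≤) (pred-+ p q))
    arith : ∀ u w x y p q t X X₁ X₂ a b c z →
      w * (2 * y) + q + 0 +
        (u * (2 * x) + p + 0 + (X + c) + ((u + w) * (2 * (x * y)) + 2) + suc t * (2 * (x * y)) + (X₁ + X₂) + (a + b) + t * (2 * z)) + 0 ≡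
      X₂ + b + (suc (X₁ + a) + (t * (2 * z) + (p + q) + 0) + (u * (2 * x) + w * (2 * y) + 2 * (x * y)) + (u + w) * (2 * (x * y)) + suc X + c + t * (2 * (x * y)))
    arith = solve-∀

  -- Serve the targets from the left as long as the pebbles up to the current one suffice;
  -- at the first failure the pebbles beyond serve the remaining targets.
  inner-targets : ∀ m C D → Below (m + total C (suc m)) → D 0 ≡ 0 → D m ≡ 0 →
                  Good m (total D (suc m)) 0 (total C (suc m) + spt D (suc m)) → Solves {k} m C D
  inner-targets m C D ih D0≡0 Dm≡0 good = scan m 0 refl (0 , stop λ { zero _ → z≤n })
    where
    advance : ∀ q p → p + q ≡ m → ∀ a → D p ≡ a → Solves {k} p C (upd D p a) → Solves {k} m C D
    scan : ∀ q p → p + q ≡ m → Solves {k} p C (upd D p 0) → Solves {k} m C D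
    advance zero p refl a Dp≡ (c , reach) = c , subst (λ m → Reach m c C D) (sym (+-identityʳ p)) (mono (λ _ _ → ≤-refl) (λ x _ → ≤-upd D p x (≤-reflexive Dp≡)) reach)
    advance (suc q) p refl a Dp≡ (c , reach) = scan q (suc p) (sym (+-suc p q)) (c , mono pebbles targets (prefix (n≤1+n p) reach))
      where
      pebbles : ∀ x → x ≤ suc p → cut p C x ≤ C x
      pebbles x _ with x ≤? p
      ... | yes x≤p = ≤-reflexive (cut-≤ p C x x≤p)
      ... | no  x≰p = ≤-trans (≤-reflexive (cut-> p C x (≰⇒> x≰p))) z≤n
      targets : ∀ x → x ≤ suc p → upd D (suc p) 0 x ≤ cut p (upd D p a) x
      targets x x≤p+1 with x ≤? p
      ... | yes x≤p = ≤-trans (≤-reflexive (upd-≢ D 0 (>⇒≢ (s≤s x≤p)))) (≤-trans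
          (≤-upd D p x (≤-reflexive Dp≡))
          (≤-reflexive (sym (cut-≤ p (upd D p a) x x≤p))))
      ... | no  x≰p with ≤-antisym x≤p+1 (≰⇒> x≰p)
      ...   | refl = ≤-trans (≤-reflexive (upd-self D (suc p) 0)) z≤n

    scan q p refl = serve (D p) 0 refl
      where
      serve : ∀ b a → a + b ≡ D p → Solves {k} p C (upd D p a) → Solves {k} m C D
      serve zero a a+0≡ r = advance q p refl a (trans (sym a+0≡) (+-identityʳ a)) r
      serve (suc b) a a+b≡ (c , reach) with good? p (total D₁ (suc p)) 0 (total C (suc p) + spt D₁ (suc p))
        where
        D₁ = upd D p (suc a)
      ... | inj₁ enough = serve b (suc a) (trans (sym (+-suc a b)) a+b≡)
          (ih p C (upd D p (suc a)) (+-mono-<-≤ p<m (≤-trans (m≤m+n _ _) (≤-reflexive (sym (total-split C (suc p) q))))) enough)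
        where
        -- `D p` is positive while both ends carry no demand; hence this part, and below likewise
        -- the right one, is strictly shorter.
        p<m : p < p + q
        p<m = ≤∧≢⇒< (m≤m+n p q) λ p≡ → 1+n≢0 (m+n≡0⇒n≡0 a (trans a+b≡ (trans (cong D p≡) Dm≡0)))
      -- The pebbles on `p` stay with the left part, hence `cons 0`; the `suc b` demands on `p`
      -- still unmet go to the right part.
      ... | inj₂ (e , ke≤ , bad) with ih q (cons 0 (λ y → C (suc (p + y)))) (cons (suc b) (λ y → D (suc (p + y))))
            (+-mono-<-≤ q<m (≤-trans (m≤n+m _ _) (≤-reflexive (sym (total-split C (suc p) q)))))
            (good-remainder {p} {X₁ = total C (suc p) + spt (upd D p (suc a)) (suc p)} 1≤u (s≤s z≤n) demands budgets ke≤ bad good)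
        where
        D₁ = upd D p (suc a)
        0<p : 0 < p
        0<p = n≢0⇒n>0 λ p≡0 → 1+n≢0 (m+n≡0⇒n≡0 a (trans a+b≡ (trans (cong D p≡0) D0≡0)))
        q<m : q < p + q
        q<m = +-monoˡ-≤ q 0<p
        served : total D₁ (suc p) + D p ≡ total D (suc p) + suc a
        served = total-upd id D (suc a) ≤-refl
        1≤u : 1 ≤ total D₁ (suc p)
        1≤u = ≤-trans (≤-trans (s≤s z≤n) (≤-reflexive (sym (upd-self D p (suc a))))) (term≤total D₁ ≤-refl)
        demands : total D₁ (suc p) + (suc b + total (λ y → D (suc (p + y))) q) ≡ suc (total D (suc (p + q)))
        demands = +-cancelʳ-≡ (D p) _ _ (trans (swap (total D₁ (suc p)) (suc b + total (λ y → D (suc (p + y))) q) (D p))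
            (trans (cong (_+ (suc b + total (λ y → D (suc (p + y))) q)) served)
              (trans (arith (total D (suc p)) a b _) (cong suc (cong₂ _+_ (sym (total-split D (suc p) q)) a+b≡)))))
          where
          swap : ∀ x y z → x + y + z ≡ x + z + y
          swap = solve-∀
          arith : ∀ T a b T' → T + suc a + (suc b + T') ≡ suc (T + T' + (a + suc b))
          arith = solve-∀
        same-support : spt D₁ (suc p) ≡ spt D (suc p)
        same-support = +-cancelʳ-≡ 1 _ _ (trans (cong (spt D₁ (suc p) +_) (sym (occ-pos {D p} (≤-trans (s≤s z≤n) (≤-trans (m≤n+m (suc b) a) (≤-reflexive a+b≡)))))) (total-upd occ D (suc a) ≤-refl))
        budgets : total C (suc p) + spt D₁ (suc p) + (total (λ y → C (suc (p + y))) q + (1 + spt (λ y → D (suc (p + y))) q)) ≡ suc (total C (suc (p + q)) + spt D (suc (p + q)))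
        budgets = trans (cong (λ s → total C (suc p) + s + (total (λ y → C (suc (p + y))) q + (1 + spt (λ y → D (suc (p + y))) q))) same-support)
          (trans (arith (total C (suc p)) (spt D (suc p)) _ _) (cong suc (cong₂ _+_ (sym (total-split C (suc p) q)) (sym (total-split (occ ∘ D) (suc p) q)))))
          where
          arith : ∀ c s c' s' → c + s + (c' + (1 + s')) ≡ suc (c + c' + (s + s'))
          arith = solve-∀
      ... | c' , reach' = _ , mono
          (λ x _ → ≤-reflexive (trans (cut-shift p C _ 0 (λ _ → refl) x) (trans (cong (C x +_) (pile-0 p x)) (+-identityʳ (C x)))))
          (λ x _ → targets x)
          (both (prefix (m≤m+n p q) reach) (shift-reach p reach'))
        where
        targets : ∀ x → D x ≤ cut p (upd D p a) x + shift p (cons (suc b) (λ y → D (suc (p + y)))) x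
        targets x = ≤-trans (≤-trans (m≤m+n (D x) _) (≤-upd-pile D p {a} {0} {suc b} x (≤-reflexive (trans (+-identityʳ _) (sym a+b≡)))))
          (≤-reflexive (sym (cut-shift p (upd D p a) _ (suc b) (λ y → sym (upd-≢ D a (<⇒≢ (s≤s (m≤m+n p y))))) x)))

  -- `N` bounds m + |C|, as every reduction loses a position or a pebble; reversing the path loses
  -- neither, but leads directly to an end target.
  solvable : ∀ N → Below N
  solvable zero    m C D () good
  solvable (suc N) m C D (s≤s lt) good = by-origin (D 0) refl
    where
    ih : Below (m + total C (suc m))
    ih m' C' D' lt' = solvable N m' C' D' (≤-trans lt' lt)
    by-end : D 0 ≡ 0 → ∀ b → D m ≡ b → Solves {k} m C D
    by-end D0≡ zero    Dm≡ = inner-targets m C D ih D0≡ Dm≡ good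
    by-end D0≡ (suc b) Dm≡ with end-target m (λ x → C (m ∸ x)) (λ x → D (m ∸ x))
      (subst (λ c → Below (m + c)) (sym (total-reverse C m)) ih)
      (≤-trans (s≤s z≤n) (≤-reflexive (sym Dm≡)))
      (subst (λ t → Good m t 0 (total (λ x → C (m ∸ x)) (suc m) + spt (λ x → D (m ∸ x)) (suc m))) (sym (total-reverse D m)) (subst (Good m (total D (suc m)) 0) (cong₂ _+_ (sym (total-reverse C m)) (sym (total-reverse (occ ∘ D) m))) good))
    ... | c , reach = c , unreverse reach
    by-origin : ∀ a → D 0 ≡ a → Solves {k} m C D
    by-origin zero    D0≡ = by-end D0≡ (D m) refl
    by-origin (suc a) D0≡ = end-target m C D ih (≤-trans (s≤s z≤n) (≤-reflexive (sym D0≡))) good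

-- Cheap solutions

halves-≤ : ∀ n → ⌊ n /2⌋ + ⌊ n /2⌋ ≤ n
halves-≤ n = ≤-trans (+-monoʳ-≤ ⌊ n /2⌋ (⌊n/2⌋≤⌈n/2⌉ n)) (≤-reflexive (⌊n/2⌋+⌈n/2⌉≡n n))

⌈n/2⌉≤1+⌊n/2⌋ : ∀ n → ⌈ n /2⌉ ≤ suc ⌊ n /2⌋
⌈n/2⌉≤1+⌊n/2⌋ zero          = z≤n
⌈n/2⌉≤1+⌊n/2⌋ (suc zero)    = ≤-refl
⌈n/2⌉≤1+⌊n/2⌋ (suc (suc n)) = s≤s (⌈n/2⌉≤1+⌊n/2⌋ n)

-- Each position leaves at most one pebble unpaired.
total-halves : ∀ C n → total C n ≤ total (⌊_/2⌋ ∘ C) n + total (⌊_/2⌋ ∘ C) n + n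
total-halves C zero    = z≤n
total-halves C (suc n) = linear 0 (≤-reflexive (sym (⌊n/2⌋+⌈n/2⌉≡n (C 0))) ⟨+⟩ ⌈n/2⌉≤1+⌊n/2⌋ (C 0) ⟨+⟩ total-halves (C ∘ suc) n)
  (arith (C 0) ⌊ C 0 /2⌋ ⌈ C 0 /2⌉ (total (C ∘ suc) n) (total (⌊_/2⌋ ∘ C ∘ suc) n) n)
  where
  arith : ∀ c a b Σ h n → c + Σ + (a + b + (1 + a) + (h + h + n)) + 0 ≡ a + h + (a + h) + suc n + (c + b + Σ)
  arith = solve-∀

shift-≤ : ∀ p {f g : ℕ → ℕ} → (∀ y → f y ≤ g (p + y)) → ∀ x → shift p f x ≤ g x
shift-≤ zero    h x       = h x
shift-≤ (suc p) h zero    = z≤n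
shift-≤ (suc p) {g = g} h (suc x) = shift-≤ p {g = g ∘ suc} h x

module _ (k' : ℕ) where

  private
    k : ℕ
    k = suc k'

  direct : ∀ e m P r → r < m → r < k → 0 < P (suc r) → ∃[ c ] (suc c ≤ 2 ^ suc e × Reach {k} m c (P ⊕ P) (pile 0 1))
  direct e m P r r<m r<k 0<Pr = 1 , *-monoʳ-≤ 2 (m^n>0 2 e) , step {C₀ = upd (P ⊕ P) (suc r) (P (suc r) + P (suc r) ∸ 2)} (suc r) 0 r<m z≤n (s≤s z≤n , r<k)
    (λ x _ → upd-pile-≤ (P ⊕ P) (suc r) x (≤-reflexive (m∸n+n≡m (+-mono-≤ 0<Pr 0<Pr))))
    (stop λ x _ → m≤n+m _ _)

  -- If no pair is within reach of 0, half of the pairs are brought to k by the induction hypothesis, and the other half too.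
  cheap : ∀ e m P → m ≤ k * suc e → 2 ^ e ≤ total (P ∘ suc) m →
          ∃[ c ] (suc c ≤ 2 ^ suc e × Reach {k} m c (P ⊕ P) (pile 0 1))
  cheap e m P m≤ enough with m ≤? k
  ... | yes m≤k with positive-term (P ∘ suc) m (≤-trans (m^n>0 2 e) enough)
  ...   | r , r<m , 0<Pr = direct e m P r r<m (≤-trans r<m m≤k) 0<Pr
  cheap e m P m≤ enough | no m≰k with search (P ∘ suc) k
  ... | inj₁ (r , r<k , 0<Pr) = direct e m P r (<-≤-trans r<k (<⇒≤ (≰⇒> m≰k))) r<k 0<Pr
  cheap zero m P m≤ enough | no m≰k | inj₂ none = contradiction (≤-trans m≤ (≤-reflexive (*-identityʳ k))) m≰k
  cheap (suc e) m P m≤ enough | no m≰k | inj₂ none = far (m ∸ k) (m+[n∸m]≡n (<⇒≤ (≰⇒> m≰k)))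
    where
    far : ∀ q → k + q ≡ m → ∃[ c ] (suc c ≤ 2 ^ suc (suc e) × Reach {k} m c (P ⊕ P) (pile 0 1))
    far q refl with total-divide (λ x → P (suc (k + x))) q (2 ^ e) (2 ^ e) (≤-trans (≤-reflexive (cong (2 ^ e +_) (sym (+-identityʳ _))))
        (≤-trans enough (≤-reflexive (trans (total-split (P ∘ suc) k q) (cong (_+ total (λ x → P (suc (k + x))) q) (total≡0 (P ∘ suc) k none))))))
    ... | g , h , g+h≤P , e≤g , e≤h with cheap e q (cons 0 g) q≤ e≤g | cheap e q (cons 0 h) q≤ e≤h
      where
      q≤ : q ≤ k * suc e
      q≤ = +-cancelˡ-≤ k q (k * suc e) (≤-trans m≤ (≤-reflexive (*-suc k (suc e))))
    ... | c₁ , c₁≤ , reach₁ | c₂ , c₂≤ , reach₂ = c₁ + c₂ + 1 , cost , chain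
      (mono (λ x _ → shift-≤ k {g = P ⊕ P} below x) (λ x _ → ≤-reflexive (sym (pile-shift k 0 2 x)))
        (shift-reach k (mono (λ _ _ → ≤-refl) (λ x _ → ≤-reflexive (sym (pile-+ 0 1 1 x))) (both reach₁ reach₂))))
      (carry {i = k + 0} 1 (+-monoʳ-≤ k z≤n) z≤n (s≤s z≤n , ≤-reflexive (+-identityʳ k)))
      where
      cost : suc (c₁ + c₂ + 1) ≤ 2 ^ suc (suc e)
      cost = linear 0 (c₁≤ ⟨+⟩ c₂≤) (arith c₁ c₂ (2 ^ suc e))
        where
        arith : ∀ a b y → suc (a + b + 1) + (y + y) + 0 ≡ 2 * y + (suc a + suc b)
        arith = solve-∀
      below : ∀ y → cons 0 g y + cons 0 g y + (cons 0 h y + cons 0 h y) ≤ P (k + y) + P (k + y)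
      below zero    = z≤n
      below (suc y) = linear 0 (g+h≤P' ⟨+⟩ g+h≤P') (arith (g y) (h y) (P (k + suc y)))
        where
        g+h≤P' : g y + h y ≤ P (k + suc y)
        g+h≤P' = ≤-trans (g+h≤P y) (≤-reflexive (cong P (sym (+-suc k y))))
        arith : ∀ a b p → a + a + (b + b) + (p + p) + 0 ≡ p + p + (a + b + (a + b))
        arith = solve-∀

  -- For x, y ≥ 1 one has x + y ≤ x y + 1, so 2^(e₁+e₂) pairs off `v` cannot fall short of 2^e₁ on
  -- the left and of 2^e₂ on the right at once.
  cheap-either-side : ∀ v q C e₁ e₂ {e} → v ≤ k * suc e₁ → q ≤ k * suc e₂ → suc e₁ ≤ e → suc e₂ ≤ e →
    2 ^ (e₁ + e₂) ≤ total (⌊_/2⌋ ∘ C) (suc (v + q)) →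
    ∃[ c ] (suc c ≤ 2 ^ e × Reach {k} (v + q) c C (pile v 1))
  cheap-either-side v q C e₁ e₂ {e} v≤ q≤ e₁<e e₂<e enough with C v in Cv≡
  ... | suc _ = 0 , m^n>0 2 e , stop λ x _ → above x
    where
    above : ∀ x → pile v 1 x ≤ C x
    above x with v ≟ x
    ... | yes refl = ≤-trans (≤-reflexive (pile-self v 1)) (≤-trans (s≤s z≤n) (≤-reflexive (sym Cv≡)))
    ... | no  v≢x  = ≤-trans (≤-reflexive (pile-≢ 1 v≢x)) z≤n
  ... | zero = by-side (2 ^ e₁ ≤? left) (2 ^ e₂ ≤? right)
    where
    P = ⌊_/2⌋ ∘ C
    left = total P v
    right = total (λ x → P (suc (v + x))) q
    sides : total P (suc (v + q)) ≡ left + right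
    sides = trans (total-split P (suc v) q) (cong (_+ right) (trans (total-last P v) (trans (cong (λ c → left + ⌊ c /2⌋) Cv≡) (+-identityʳ left))))
    by-side : _ → _ → ∃[ c ] (suc c ≤ 2 ^ e × Reach {k} (v + q) c C (pile v 1))
    by-side (yes on-left) _ with cheap e₁ v (λ x → P (v ∸ x)) v≤ (≤-trans on-left (≤-reflexive (sym (reversed v))))
      where
      reversed : ∀ v → total (λ x → P (v ∸ suc x)) v ≡ total P v
      reversed zero    = refl
      reversed (suc v) = total-reverse P v
    ... | c , c< , reach = c , ≤-trans c< (^-monoʳ-≤ 2 e₁<e) , mono below above (prefix (m≤m+n v q) (unreverse {D = pile v 1} (mono (λ _ _ → ≤-refl) flip reach)))
      where
      flip : ∀ x → x ≤ v → pile v 1 (v ∸ x) ≤ pile 0 1 x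
      flip x x≤v = ≤-reflexive (trans (sym (pile-reverse {k} 1 ≤-refl x≤v)) (cong (λ i → pile i 1 x) (n∸n≡0 v)))
      below : ∀ x → x ≤ v + q → cut v (P ⊕ P) x ≤ C x
      below x _ with x ≤? v
      ... | yes x≤v = ≤-trans (≤-reflexive (cut-≤ v (P ⊕ P) x x≤v)) (halves-≤ (C x))
      ... | no  x≰v = ≤-trans (≤-reflexive (cut-> v (P ⊕ P) x (≰⇒> x≰v))) z≤n
      above : ∀ x → x ≤ v + q → pile v 1 x ≤ cut v (pile v 1) x
      above x _ with x ≤? v
      ... | yes x≤v = ≤-reflexive (sym (cut-≤ v (pile v 1) x x≤v))
      ... | no  x≰v = ≤-trans (≤-reflexive (pile-≢ {v} {x} 1 λ { refl → x≰v ≤-refl })) z≤n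
    by-side (no _) (yes on-right) with cheap e₂ q (λ x → P (v + x)) q≤ (≤-trans on-right (≤-reflexive (total-cong q λ x _ → cong P (sym (+-suc v x)))))
    ... | c , c< , reach = c , ≤-trans c< (^-monoʳ-≤ 2 e₂<e) , mono
      (λ x _ → ≤-trans (shift-≤ v {g = P ⊕ P} (λ _ → ≤-refl) x) (halves-≤ (C x)))
      (λ x _ → ≤-reflexive (sym (trans (pile-shift v 0 1 x) (cong (λ i → pile i 1 x) (+-identityʳ v)))))
      (shift-reach v reach)
    by-side (no few-left) (no few-right) = contradiction
      (linear {a = 1} {b = 0} {c = suc left + suc right + (2 ^ e₁ + 2 ^ e₂) + 2 ^ (e₁ + e₂) + 2 ^ e₁ * 2 ^ e₂} 0 (≰⇒> few-left ⟨+⟩ ≰⇒> few-right ⟨+⟩ product (m^n>0 2 e₁) (m^n>0 2 e₂) ⟨+⟩ ≤-trans enough (≤-reflexive sides) ⟨+⟩ ≤-reflexive (sym (^-distribˡ-+-* 2 e₁ e₂)))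
        (arith left right (2 ^ e₁) (2 ^ e₂) (2 ^ (e₁ + e₂)))) 1+n≰n
      where
      product : ∀ {x y} → 1 ≤ x → 1 ≤ y → x + y ≤ suc (x * y)
      product {suc x} {suc y} _ _ = linear {c = 0} (x * y) z≤n (arith x y)
        where
        arith : ∀ x y → suc x + suc y + 0 + x * y ≡ suc (suc x * suc y) + 0
        arith = solve-∀
      arith : ∀ a b x y z → 1 + (x + y + suc (x * y) + (a + b) + z) + 0 ≡ 0 + (suc a + suc b + (x + y) + z + x * y)
      arith = solve-∀

-- From intervals to the graph

ext : ∀ {n} → (Fin n → ℕ) → ℕ → ℕ
ext {zero}  f x       = 0
ext {suc n} f zero    = f zero
ext {suc n} f (suc x) = ext (f ∘ suc) x

ext-toℕ : ∀ {n} (f : Fin n → ℕ) v → ext f (toℕ v) ≡ f v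
ext-toℕ f zero    = refl
ext-toℕ f (suc v) = ext-toℕ (f ∘ suc) v

total-ext : ∀ (h : ℕ → ℕ) {n} (C f : Fin n → ℕ) → (∀ v → f v ≡ h (C v)) → sum (tabulate f) ≡ total (h ∘ ext C) n
total-ext h {zero}  C f f≡ = refl
total-ext h {suc n} C f f≡ = cong₂ _+_ (f≡ zero) (total-ext h (C ∘ suc) (f ∘ suc) (f≡ ∘ suc))

sum-mono : ∀ {n} (f g : Fin n → ℕ) a b → (∀ v → f v + a (toℕ v) ≤ g v + b (toℕ v)) →
           sum (tabulate f) + total a n ≤ sum (tabulate g) + total b n
sum-mono {zero}  f g a b h = z≤n
sum-mono {suc n} f g a b h = linear 0 (+-mono-≤ (h zero) (sum-mono (f ∘ suc) (g ∘ suc) (a ∘ suc) (b ∘ suc) (h ∘ suc)))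
  (arith (f zero) (g zero) (a 0) (b 0) (sum (tabulate (f ∘ suc))) (sum (tabulate (g ∘ suc))) (total (a ∘ suc) n) (total (b ∘ suc) n))
  where
  arith : ∀ f g a b F G A B → f + F + (a + A) + (g + b + (G + B)) + 0 ≡ g + G + (b + B) + (f + a + (F + A))
  arith = solve-∀

size≡ : ∀ {n} (C : Config n) → size C ≡ total (ext C) n
size≡ C = total-ext id C C λ _ → refl

-- The summand of the support is local to its definition in Defs; unification names it.
support-summand : ∀ {n} (D : Config n) → Σ (Fin n → ℕ) λ f → support D ≡ sum (tabulate f)
support-summand D = _ , refl

support≡ : ∀ {n} (D : Config n) → support D ≡ spt (ext D) n
support≡ D = total-ext occ D (proj₁ (support-summand D)) summand
  where
  summand : ∀ v → proj₁ (support-summand D) v ≡ occ (D v)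
  summand v with D v
  ... | zero  = refl
  ... | suc _ = refl

move-≥ : ∀ {n} (u v : Fin n) C w x → x + pile (toℕ u) 2 (toℕ w) ≤ C w → x + pile (toℕ v) 1 (toℕ w) ≤ move u v C w
move-≥ u v C w x x≤ with w ≟ᶠ u | w ≟ᶠ v
... | yes refl | yes refl rewrite pile-self (toℕ w) 1 | pile-self (toℕ w) 2 = +-monoˡ-≤ 1 (m+n≤o⇒m≤o∸n x x≤)
... | yes refl | no w≢v rewrite pile-self (toℕ w) 2 | pile-≢ {toℕ v} {toℕ w} 1 (w≢v ∘ sym ∘ toℕ-injective) = +-monoˡ-≤ 0 (m+n≤o⇒m≤o∸n x x≤)
... | no w≢u | yes refl rewrite pile-self (toℕ w) 1 = +-monoˡ-≤ 1 (m+n≤o⇒m≤o x x≤)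
... | no w≢u | no w≢v rewrite pile-≢ {toℕ v} {toℕ w} 1 (w≢v ∘ sym ∘ toℕ-injective) = +-monoˡ-≤ 0 (m+n≤o⇒m≤o x x≤)

steps : ∀ {k m c C D} → Reach {k} m c C D → (C₁ : Config (suc m)) → (∀ v → C (toℕ v) ≤ C₁ v) →
        ∃[ C' ] (Steps k c C₁ C' × (∀ v → D (toℕ v) ≤ C' v))
steps (stop D≤C) C₁ C≤C₁ = C₁ , done , λ v → ≤-trans (D≤C (toℕ v) (≤-pred (toℕ<n v))) (C≤C₁ v)
steps {k} {m} (step {C₀ = C₀} i j i≤m j≤m near C₀≤C r) C₁ C≤C₁
  = let C' , s , D≤C' = steps r (move u w C₁) moved in
    C' , step u w (subst₂ (λ i j → 1 ≤ ∣ i - j ∣ × ∣ i - j ∣ ≤ k) (sym u≡) (sym w≡) near) enough s , D≤C'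
  where
  u w : Fin (suc m)
  u = fromℕ< (s≤s i≤m)
  w = fromℕ< (s≤s j≤m)
  u≡ : toℕ u ≡ i
  u≡ = toℕ-fromℕ< (s≤s i≤m)
  w≡ : toℕ w ≡ j
  w≡ = toℕ-fromℕ< (s≤s j≤m)
  below : ∀ v → C₀ (toℕ v) + pile (toℕ u) 2 (toℕ v) ≤ C₁ v
  below v = ≤-trans (≤-reflexive (cong (λ i → C₀ (toℕ v) + pile i 2 (toℕ v)) u≡)) (≤-trans (C₀≤C (toℕ v) (≤-pred (toℕ<n v))) (C≤C₁ v))
  moved : ∀ v → C₀ (toℕ v) + pile j 1 (toℕ v) ≤ move u w C₁ v
  moved v = ≤-trans (≤-reflexive (cong (λ j → C₀ (toℕ v) + pile j 1 (toℕ v)) (sym w≡))) (move-≥ u w C₁ v (C₀ (toℕ v)) (below v))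
  enough : 2 ≤ C₁ u
  enough = ≤-trans (m≤n+m 2 (C₀ (toℕ u))) (≤-trans (≤-reflexive (cong (C₀ (toℕ u) +_) (sym (pile-self (toℕ u) 2)))) (below u))

walk-∣-∣ : ∀ {n k ℓ} {u v : Fin n} → Walk k u v ℓ → ∣ toℕ u - toℕ v ∣ ≤ k * ℓ
walk-∣-∣ {u = u} here = ≤-trans (≤-reflexive (∣n-n∣≡0 (toℕ u))) z≤n
walk-∣-∣ {k = k} {ℓ = suc ℓ} {u} {v} (there {w = w} (_ , near) walk) =
  ≤-trans (∣-∣-triangle (toℕ u) (toℕ w) (toℕ v)) (≤-trans (+-mono-≤ near (walk-∣-∣ walk)) (≤-reflexive (sym (*-suc k ℓ))))

-- Used with `u` at either end of the path, to bound the eccentricity from below.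
ecc-∣-∣ : ∀ {n k e} {v : Fin n} → IsEcc k v e → ∀ u → ∣ toℕ v - toℕ u ∣ ≤ k * e
ecc-∣-∣ {k = k} (within , _) u with within u
... | d , (walk , _) , d≤e = ≤-trans (walk-∣-∣ walk) (*-monoʳ-≤ k d≤e)

-- The potential as an obstruction to solvability

potential : ℕ → ℕ → ℕ
potential d c = (c ⊓ d) + (c ∸ d) / 2

half-+2 : ∀ c → (2 + c) / 2 ≡ 1 + c / 2
half-+2 c = +-distrib-/-∣ˡ {2} c {2} (divides 1 refl)

potential-remove : ∀ d c → potential d c + 1 ≤ potential d (2 + c)
potential-remove zero          c rewrite ⊓-zeroʳ c | half-+2 c = ≤-reflexive (+-comm (c / 2) 1)
potential-remove (suc d)       zero    = s≤s z≤n
potential-remove (suc d)       (suc c) = s≤s (potential-remove d c)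

potential-0 : ∀ d → potential d 0 ≡ 0
potential-0 d rewrite 0∸n≡0 d = refl

potential-add : ∀ d c → potential d (1 + c) ≤ potential d c + 1
potential-add zero    c rewrite ⊓-zeroʳ c =
  ≤-trans (/-monoˡ-≤ 2 (n≤1+n (1 + c))) (≤-reflexive (trans (half-+2 c) (+-comm 1 (c / 2))))
potential-add (suc d) zero    = s≤s (≤-reflexive (potential-0 d))
potential-add (suc d) (suc c) = s≤s (potential-add d c)

potential-full : ∀ {d c} → d ≤ c → d ≤ potential d c
potential-full d≤c = ≤-trans (≤-reflexive (sym (m≥n⇒m⊓n≡n d≤c))) (m≤m+n _ _)

total-pile : ∀ i a {n} → i < n → total (pile i a) n ≡ a
total-pile zero    a {suc n} _         = trans (cong (a +_) (total≡0 _ n λ _ _ → refl)) (+-identityʳ a)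
total-pile (suc i) a {suc n} (s≤s i<n) = total-pile i a i<n

-- Taking two pebbles lowers the potential by at least one, adding one raises it by at most one; the
-- unit piles at `u` and `v` carry this balance through the sum.
pot-move : ∀ {n} (D : Config n) u v C → 2 ≤ C u → pot D (move u v C) ≤ pot D C
pot-move {n} D u v C 2≤Cu = +-cancelʳ-≤ 1 _ _ (≤-trans
  (≤-reflexive (cong (pot D (move u v C) +_) (sym (total-pile (toℕ u) 1 (toℕ<n u)))))
  (≤-trans (sum-mono (λ w → potential (D w) (move u v C w)) (λ w → potential (D w) (C w)) (pile (toℕ u) 1) (pile (toℕ v) 1) local)
    (≤-reflexive (cong (pot D C +_) (total-pile (toℕ v) 1 (toℕ<n v))))))
  where
  remove : ∀ w → w ≡ u → potential (D w) (C w ∸ 2) + 1 ≤ potential (D w) (C w)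
  remove w refl = ≤-trans (potential-remove (D w) (C w ∸ 2)) (≤-reflexive (cong (potential (D w)) (m+[n∸m]≡n 2≤Cu)))
  local : ∀ w → potential (D w) (move u v C w) + pile (toℕ u) 1 (toℕ w) ≤ potential (D w) (C w) + pile (toℕ v) 1 (toℕ w)
  local w with w ≟ᶠ u | w ≟ᶠ v
  ... | yes refl | yes refl = +-monoˡ-≤ _ (≤-trans (≤-reflexive (cong (potential (D w)) (+-comm _ 1))) (≤-trans (potential-add (D w) _) (remove w refl)))
  ... | yes refl | no w≢v rewrite pile-self (toℕ w) 1 | pile-≢ {toℕ v} {toℕ w} 1 (w≢v ∘ sym ∘ toℕ-injective) | +-identityʳ (C w ∸ 2) =
    ≤-trans (remove w refl) (m≤m+n _ 0)
  ... | no w≢u | yes refl rewrite pile-self (toℕ w) 1 | pile-≢ {toℕ u} {toℕ w} 1 (w≢u ∘ sym ∘ toℕ-injective) | +-comm (C w) 1 =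
    ≤-trans (≤-reflexive (+-identityʳ _)) (potential-add (D w) (C w))
  ... | no w≢u | no w≢v rewrite pile-≢ {toℕ u} {toℕ w} 1 (w≢u ∘ sym ∘ toℕ-injective) | pile-≢ {toℕ v} {toℕ w} 1 (w≢v ∘ sym ∘ toℕ-injective) | +-identityʳ (C w) = ≤-refl

pot-steps : ∀ {n k c} {C C' : Config n} D → Steps k c C C' → pot D C' ≤ pot D C
pot-steps D done = ≤-refl
pot-steps {C = C} D (step u v _ 2≤Cu s) = ≤-trans (pot-steps D s) (pot-move D u v C 2≤Cu)

solvable⇒pot : ∀ {n k} {D C : Config n} → Solvable k D C → size D ≤ pot D C
solvable⇒pot {n} {D = D} {C} (c , C' , s , D≤C') = ≤-trans
  (+-cancelʳ-≤ (total (λ _ → 0) n) _ _ (sum-mono D (λ v → potential (D v) (C' v)) (λ _ → 0) (λ _ → 0) λ v → +-monoˡ-≤ 0 (potential-full (D≤C' v))))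
  (pot-steps D s)

-- The numerical bounds

fraction-≤ : ∀ a b c d .{{_ : NonZero b}} .{{_ : NonZero d}} → ℤ.+ a ℚ./ b ℚ.≤ ℤ.+ c ℚ./ d → a * d ≤ c * b
fraction-≤ a (suc b) c (suc d) le = ℤ.drop‿+≤+ (subst₂ ℤ._≤_ (sym (ℤ.pos-* a (suc d))) (sym (ℤ.pos-* c (suc b)))
  (ℚᵘ.drop-*≤* (ℚᵘ.≤-respˡ-≃ (ℚ.toℚᵘ-fromℚᵘ (mkℚᵘ (ℤ.+ a) b)) (ℚᵘ.≤-respʳ-≃ (ℚ.toℚᵘ-fromℚᵘ (mkℚᵘ (ℤ.+ c) d)) (ℚ.toℚᵘ-mono-≤ le)))))

floor≤ : ∀ p → ℚ.floor p ℤ.* ↧ p ℤ.≤ ↥ p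
floor≤ p@record{} = ℤ.[n/d]*d≤n (↥ p) (↧ p)

≤ceiling : ∀ q → ↥ q ℤ.≤ ℚ.ceiling q ℤ.* ↧ q
≤ceiling q@record{} = subst₂ ℤ._≤_ (ℤ.neg-involutive (↥ q))
  (trans (ℤ.neg-distribˡ-* (ℚ.floor (ℚ.- q)) (↧ (ℚ.- q))) (cong ((ℚ.ceiling q) ℤ.*_) (ℚ.↧-neg q)))
  (ℤ.neg-mono-≤ (subst (ℚ.floor (ℚ.- q) ℤ.* ↧ (ℚ.- q) ℤ.≤_) (ℚ.↥-neg q) (floor≤ (ℚ.- q))))

ceiling-< : ∀ q t → ℚ.ceiling q ℤ.< ℤ.+ suc t → q ℚ.≤ ℤ.+ t ℚ./ 1
ceiling-< q@record{} t lt = ℚ.toℚᵘ-cancel-≤ (ℚᵘ.≤-respʳ-≃ (ℚᵘ.≃-sym (ℚ.toℚᵘ-fromℚᵘ (mkℚᵘ (ℤ.+ t) 0)))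
  (ℚᵘ.*≤* (subst (ℤ._≤ (ℤ.+ t) ℤ.* ↧ q) (sym (ℤ.*-identityʳ (↥ q)))
    (ℤ.≤-trans (≤ceiling q) (ℤ.*-monoʳ-≤-nonNeg (↧ q) (ℤ.i<j⇒i≤pred[j] lt))))))

*-∸-≤ : ∀ {a b c d} → a * (b ∸ c) ≤ d → a * b ≤ d + a * c
*-∸-≤ {a} {b} {c} {d} le = ≤-trans (m≤n+m∸n (a * b) (a * c)) (≤-trans (≤-reflexive (trans (cong ((a * c) +_) (sym (*-distribˡ-∸ a b c))) (+-comm (a * c) _))) (+-monoˡ-≤ (a * c) le))

-- The first bound clears the denominator 2^d - 2. The second, which for d ≥ 2 follows from 4 t ≤ t
-- 2^d, gives t < n and hence a vertex without demand.
wide-bound : ∀ E t k → (ℤ.+ t ℚ./ 1) ℚ.≤ t0Of (suc E) k → t * 2 ^ suc E ≤ k * E + t * 2 × t < 2 + k * E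
wide-bound zero t k wide = ≤-trans (≤-reflexive refl) (m≤n+m (t * 2) (k * 0)) , s≤s (≤-trans t≤1 (m≤m+n 1 (k * 0)))
  where
  t≤1 : t ≤ 1
  t≤1 = subst (_≤ 1) (*-identityʳ t) (fraction-≤ t 1 1 1 wide)
wide-bound (suc e) t k wide = bound , s≤s (m≤n⇒m≤1+n (+-cancelʳ-≤ (t * 2 + t) t (k * suc e) (≤-trans (≤-trans (≤-trans (≤-reflexive (arith t)) (*-monoʳ-≤ t (*-monoʳ-≤ 2 (*-monoʳ-≤ 2 (m^n>0 2 e))))) bound) (+-monoʳ-≤ (k * suc e) (m≤m+n (t * 2) t)))))
  where
  instance
    nz = nonZero-2^[2+e]∸2 e
  bound : t * 2 ^ suc (suc e) ≤ k * suc e + t * 2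
  bound = *-∸-≤ {t} (≤-trans (fraction-≤ t 1 (k * suc e) (2 ^ suc (suc e) ∸ 2) wide) (≤-reflexive (*-identityʳ _)))
  arith : ∀ t → t + (t * 2 + t) ≡ t * (2 * (2 * 1))
  arith = solve-∀

-- To be read with `t` one less than |D|: then t₀ ≤ `t`, and t₀ > 0 makes `t` positive.
long-bound : ∀ E t k → 1 ≤ k → ℚ.ceiling (t0Of (suc E) k) ℤ.< ℤ.+ suc t → k * E + t * 2 ≤ t * 2 ^ suc E × 1 ≤ t
long-bound zero t k 1≤k long = ≤-reflexive (cong (_+ t * 2) (*-zeroʳ k)) , ≤-trans (fraction-≤ 1 1 t 1 (ceiling-< ℚ.1ℚ t long)) (≤-reflexive (*-identityʳ t))
long-bound (suc e) t k 1≤k long = ≤-trans (+-monoˡ-≤ (t * 2) bound) (≤-reflexive (trans (sym (*-distribˡ-+ t _ 2)) (cong (t *_) (m∸n+n≡m (<⇒≤ (2<2^[2+e] e))))))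
  , n≢0⇒n>0 λ { refl → 1+n≰n (≤-trans (*-mono-≤ 1≤k (s≤s (z≤n {e}))) bound) }
  where
  instance
    nz = nonZero-2^[2+e]∸2 e
  bound : k * suc e ≤ t * (2 ^ suc (suc e) ∸ 2)
  bound = ≤-trans (≤-reflexive (sym (*-identityʳ _))) (fraction-≤ (k * suc e) (2 ^ suc (suc e) ∸ 2) t 1 (ceiling-< (t0Of (suc (suc e)) k) t long))

module _ (k' : ℕ) (t p : ℕ) where
  private
    k = suc k'
    E = p / k

  dP≡ : dP (2 + p) k ≡ suc E
  dP≡ = +-comm E 1

  k*E≤p : k * E ≤ p
  k*E≤p = ≤-trans (≤-reflexive (*-comm k E)) (m/n*n≤m p k)

  pP≡ : pP t (2 + p) k ≡ (t * 2 ^ suc E + (p ∸ k * E)) ⊔ (t * 2 + p)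
  pP≡ = cong₂ _⊔_ (cong (λ d → t * 2 ^ d + (p ∸ k * (d ∸ 1))) dP≡) (trans (+-∸-assoc (2 * t) {2 + p} {2} (s≤s (s≤s z≤n))) (cong (_+ p) (*-comm 2 t)))

  pP-long : t * 2 ^ suc E + p ≤ pP t (2 + p) k + k * E
  pP-long = ≤-trans (≤-reflexive (trans (cong ((t * 2 ^ suc E) +_) (sym (m∸n+n≡m k*E≤p))) (sym (+-assoc (t * 2 ^ suc E) _ _))))
    (+-monoˡ-≤ (k * E) (≤-trans (m≤m⊔n _ (t * 2 + p)) (≤-reflexive (sym pP≡))))

  pP-wide : t * 2 + p ≤ pP t (2 + p) k
  pP-wide = ≤-trans (m≤n⊔m (t * 2 ^ suc E + (p ∸ k * E)) _) (≤-reflexive (sym pP≡))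

  wide⇒pP≡ : t * 2 ^ suc E ≤ k * E + t * 2 → pP t (2 + p) k ≡ t * 2 + p
  wide⇒pP≡ le = trans pP≡ (m≤n⇒m⊔n≡n (≤-trans (+-monoˡ-≤ (p ∸ k * E) le)
    (≤-reflexive (trans (arith (k * E) (t * 2) (p ∸ k * E)) (cong ((t * 2) +_) (m+[n∸m]≡n k*E≤p))))))
    where
    arith : ∀ a b c → a + b + c ≡ b + (a + c)
    arith = solve-∀

  -- The function t 2^(e+1) - k e is convex in e, so its maximum over 0..E is at 0 or at E.
  pP-good : ∀ X → suc (pP t (2 + p) k) ≤ X → Good k' (suc p) t 0 X
  pP-good X pP<X .Good.bound e ke≤p with k ≤? t * 2 ^ suc e
  -- From `e` on, each increment is at least t 2^(e+1) - k ≥ 0, so the term at `E` dominates.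
  ... | yes k≤ = linear 0 (pP<X ⟨+⟩ pP-long ⟨+⟩ growth (E ∸ e) ⟨+⟩ ≤-reflexive (cong (λ x → t * 2 ^ suc x) (m+[n∸m]≡n e≤E))
        ⟨+⟩ ≤-reflexive (trans (cong (k *_) (sym (m+[n∸m]≡n e≤E))) (*-distribˡ-+ k e (E ∸ e))))
      (arith (t * 2 ^ suc e) (t * 2 ^ suc (e + (E ∸ e))) (t * 2 ^ suc E) p (k * e) (k * (E ∸ e)) (k * E) X (pP t (2 + p) k))
    where
    e≤E : e ≤ E
    e≤E = ≤-trans (≤-reflexive (sym (m*n/m≡n e k))) (/-monoˡ-≤ k ke≤p)
      where
      m*n/m≡n : ∀ n m .{{_ : NonZero m}} → m * n / m ≡ n
      m*n/m≡n n m = trans (cong (_/ m) (*-comm m n)) (m*n/n≡m n m)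
    growth : ∀ f → t * 2 ^ suc e + k * f ≤ t * 2 ^ suc (e + f)
    growth zero    = ≤-reflexive (trans (cong ((t * 2 ^ suc e) +_) (*-zeroʳ k)) (trans (+-identityʳ _) (cong (λ x → t * 2 ^ suc x) (sym (+-identityʳ e)))))
    growth (suc f) = linear 0 (growth f ⟨+⟩ k≤ ⟨+⟩ *-monoʳ-≤ t (^-monoʳ-≤ 2 (s≤s (m≤m+n e f))) ⟨+⟩ ≤-reflexive (*-suc k f) ⟨+⟩ ≤-reflexive (cong (λ x → t * 2 ^ suc x) (sym (+-suc e f))))
      (double (t * 2 ^ suc e) t (2 ^ suc (e + f)) k (k * f) (k * suc f) (t * 2 ^ suc (e + suc f)))
      where
      double : ∀ a t z k kf ks w → a + ks + (t * z + a + t * z + (k + kf) + w) + 0 ≡ w + (a + kf + k + a + ks + t * (2 * z))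
      double = solve-∀
    arith : ∀ a b c p ke kf kE X P → a + suc p + 0 + (X + (P + kE) + b + c + (ke + kf)) + 0 ≡ X + ke + (suc P + (c + p) + (a + kf) + b + kE)
    arith = solve-∀
  ... | no k≰ = small e (≰⇒> k≰)
    where
    small : ∀ e → t * 2 ^ suc e < k → t * 2 ^ suc e + suc p + 0 ≤ X + k * e
    small zero    _  = linear {c = suc (pP t (2 + p) k) + (t * 2 + p)} (k * 0) (pP<X ⟨+⟩ pP-wide) (arith₀ t p X (pP t (2 + p) k) (k * 0))
      where
      arith₀ : ∀ t p X P z → t * 2 + suc p + 0 + (X + P) + z ≡ X + z + (suc P + (t * 2 + p))
      arith₀ = solve-∀
    -- Now t 2^(e+2) < k ≤ k (e + 1): the difference is negative and the term at 0 dominates.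
    small (suc e) lt = linear {c = suc (pP t (2 + p) k) + (t * 2 + p) + t * 2 ^ suc (suc e) + (k + k * e)} (t * 2 + k * e) (pP<X ⟨+⟩ pP-wide ⟨+⟩ <⇒≤ lt ⟨+⟩ ≤-reflexive (sym (*-suc k e)))
      (arith₁ (t * 2) p X (pP t (2 + p) k) (t * 2 ^ suc (suc e)) k (k * e) (k * suc e))
      where
      arith₁ : ∀ t2 p X P y k ke ks → y + suc p + 0 + (X + P + k + ks) + (t2 + ke) ≡ X + ks + (suc P + (t2 + p) + y + (k + ke))
      arith₁ = solve-∀

-- The theorem

sum-cong : ∀ {n} (f g : Fin n → ℕ) a b → (∀ v → f v + a (toℕ v) ≡ g v + b (toℕ v)) →
           sum (tabulate f) + total a n ≡ sum (tabulate g) + total b n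
sum-cong f g a b h = ≤-antisym (sum-mono f g a b (≤-reflexive ∘ h)) (sum-mono g f b a (≤-reflexive ∘ sym ∘ h))

sum-const : ∀ n c → sum (tabulate {n = n} λ _ → c) ≡ n * c
sum-const zero    c = refl
sum-const (suc n) c = cong (c +_) (sum-const n c)

module _ {n} (D : Config n) (t' : ℕ) (r : Fin n) (Dr≡0 : D r ≡ 0) where

  -- One pebble on each vertex without demand and 2 t' more on r: all of them have odd piles, so the potential is only t'.
  odd-config : Config n
  odd-config v = (1 ∸ occ (D v)) + (pile (toℕ r) t' (toℕ v) + pile (toℕ r) t' (toℕ v))

  private
    at-target : ∀ v {d} → D v ≡ suc d → pile (toℕ r) t' (toℕ v) ≡ 0
    at-target v Dv≡ = pile-≢ {toℕ r} {toℕ v} t' λ r≡v → 1+n≢0 (trans (sym Dv≡) (trans (cong D (sym (toℕ-injective r≡v))) Dr≡0))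

  odd-config-size : size odd-config + support D ≡ n + (t' + t')
  odd-config-size = trans (cong (size odd-config +_) (support≡ D)) (trans
    (sum-cong odd-config (λ _ → 1) (occ ∘ ext D) (pile (toℕ r) (t' + t')) local)
    (cong₂ _+_ (trans (sum-const n 1) (*-identityʳ n)) (total-pile (toℕ r) (t' + t') (toℕ<n r))))
    where
    local : ∀ v → odd-config v + occ (ext D (toℕ v)) ≡ 1 + pile (toℕ r) (t' + t') (toℕ v)
    local v rewrite ext-toℕ D v | sym (pile-+ (toℕ r) t' t' (toℕ v)) with D v in Dv≡
    ... | zero  = +-identityʳ _
    ... | suc d rewrite at-target v Dv≡ = refl

  odd-config-pot : pot D odd-config ≡ t'
  odd-config-pot = +-cancelʳ-≡ (total (λ _ → 0) n) _ _ (trans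
    (sum-cong (λ v → potential (D v) (odd-config v)) (λ _ → 0) (λ _ → 0) (pile (toℕ r) t') local)
    (trans (cong₂ _+_ (trans (sum-const n 0) (*-zeroʳ n)) (total-pile (toℕ r) t' (toℕ<n r)))
      (sym (trans (cong (t' +_) (total≡0 _ n λ _ _ → refl)) (+-identityʳ t')))))
    where
    half-odd : ∀ (x : ℕ) → (1 + (x + x)) / 2 ≡ x
    half-odd zero    = refl
    half-odd (suc x) = trans (cong (λ y → (1 + suc y) / 2) (+-suc x x)) (trans (half-+2 (1 + (x + x))) (cong suc (half-odd x)))
    local : ∀ v → potential (D v) (odd-config v) + 0 ≡ 0 + pile (toℕ r) t' (toℕ v)
    local v with D v in Dv≡
    ... | zero  = trans (+-identityʳ _) (half-odd _)
    ... | suc d rewrite at-target v Dv≡ = refl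

untargeted : ∀ {n} (D : Config n) → size D < n → ∃[ r ] D r ≡ 0
untargeted {n} D few with any? (λ v → D v ≟ 0)
... | yes found = found
... | no  none  = contradiction (≤-trans (≤-reflexive (trans (sym (*-identityʳ n)) (sym (sum-const n 1))))
      (+-cancelʳ-≤ (total (λ _ → 0) n) _ _ (sum-mono (λ _ → 1) D (λ _ → 0) (λ _ → 0) λ v → +-monoˡ-≤ 0 (n≢0⇒n>0 λ Dv≡0 → none (v , Dv≡0)))))
      (<⇒≱ few)

module _ (k' p : ℕ) (D : Config (2 + p)) where
  private
    k = suc k'
    t = size D
    E = p / k

  support≤size : support D ≤ size D
  support≤size = ≤-trans (≤-reflexive (support≡ D)) (≤-trans (spt≤total (ext D) (2 + p)) (≤-reflexive (sym (size≡ D))))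

  bound⇒ : ∀ {C : Config (2 + p)} → pP t (2 + p) k + 1 ∸ support D ≤ size C → suc (pP t (2 + p) k) ≤ size C + support D
  bound⇒ {C} big = ≤-trans (≤-reflexive (+-comm 1 _)) (≤-trans (m≤n+m∸n _ (support D)) (≤-trans (+-monoʳ-≤ (support D) big) (≤-reflexive (+-comm (support D) _))))

  all-solvable : AllSolvableFrom k D (pP t (2 + p) k + 1 ∸ support D)
  all-solvable C big
    with solvable k' (suc (suc p + total (ext C) (2 + p))) (suc p) (ext C) (ext D) ≤-refl
      (subst₂ (λ t X → Good k' (suc p) t 0 X) (size≡ D) (cong₂ _+_ (size≡ C) (support≡ D)) (pP-good k' t p _ (bound⇒ {C} big)))
  ... | c , reach with steps reach C (λ v → ≤-reflexive (ext-toℕ C v))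
  ...   | C' , s , D≤C' = c , C' , s , λ v → ≤-trans (≤-reflexive (sym (ext-toℕ D v))) (D≤C' v)

  wide⇒small : 1 ≤ t → Wide t (2 + p) k → Small k D
  wide⇒small 1≤t wide with wide-bound E t k (subst (λ d → (ℤ.+ t ℚ./ 1) ℚ.≤ t0Of d k) (dP≡ k' t p) wide)
  ... | t≤t₀ , t<n with untargeted D (≤-trans t<n (+-monoʳ-≤ 2 (k*E≤p k' t p)))
  -- One configuration shows both that `m` is least and that the graph is small: its potential t - 1
  -- rules out a solution, and its size is m - 1.
  ...   | r , Dr≡0 = m , (all-solvable , minimal) , C , size-C , unsolvable , pot-C
    where
    m = pP t (2 + p) k + 1 ∸ support D
    C = odd-config D (t ∸ 1) r Dr≡0
    pot-C : pot D C + 1 ≡ t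
    pot-C = trans (cong (_+ 1) (odd-config-pot D (t ∸ 1) r Dr≡0)) (m∸n+n≡m 1≤t)
    unsolvable : ¬ Solvable k D C
    unsolvable s = <⇒≱ (≤-reflexive (trans (+-comm 1 _) pot-C)) (solvable⇒pot s)
    size-C : size C + 1 ≡ m
    size-C = sym (trans (cong (λ x → x + 1 ∸ support D) (wide⇒pP≡ k' t p t≤t₀))
      (trans (cong (_∸ support D) total-pebbles) (m+n∸n≡m (size C + 1) (support D))))
      where
      arith : ∀ u p → (u + 1) * 2 + p + 1 ≡ 2 + p + (u + u) + 1
      arith = solve-∀
      swap : ∀ a b → a + b + 1 ≡ a + 1 + b
      swap = solve-∀
      total-pebbles : t * 2 + p + 1 ≡ size C + 1 + support D
      total-pebbles = trans (cong (λ t → t * 2 + p + 1) (sym (m∸n+n≡m 1≤t))) (trans (arith (t ∸ 1) p)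
        (trans (cong (_+ 1) (sym (odd-config-size D (t ∸ 1) r Dr≡0))) (swap (size C) (support D))))
    minimal : ∀ m' → m' < m → ¬ AllSolvableFrom k D m'
    minimal m' m'<m all = unsolvable (all C (≤-pred (≤-trans m'<m (≤-reflexive (trans (sym size-C) (+-comm (size C) 1))))))

  long⇒cheap : 1 ≤ t → StrictlyLong t (2 + p) k → (C : Config (2 + p)) → pP t (2 + p) k + 1 ∸ support D ≤ size C →
               (v : Fin (2 + p)) → (e : ℕ) → IsEcc k v e → SolvesWithCost k C v (2 ^ e)
  long⇒cheap 1≤t long C big v e ecc
    -- For x ≥ 1, (x - 1)/k + 1 is the rounded-up x/k, the distance from `v` to that end; so the
    -- exponents are these distances less one.
    with cheap-either-side k' x q (ext C) ((x ∸ 1) / k) ((q ∸ 1) / k) (layers x) (layers q) (within x x≤) (within q q≤) enough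
    where
    x = toℕ v
    q = suc p ∸ x
    x+q≡ : x + q ≡ suc p
    x+q≡ = m+[n∸m]≡n (≤-pred (toℕ<n v))
    layers : ∀ x → x ≤ k * suc ((x ∸ 1) / k)
    layers zero    = z≤n
    layers (suc x) = m<n*[1+m/n] x
      where
      m<n*[1+m/n] : ∀ x → x < k * suc (x / k)
      m<n*[1+m/n] x = ≤-trans (s≤s (≤-reflexive (m≡m%n+[m/n]*n x k))) (≤-trans (+-monoˡ-≤ (x / k * k) (m%n<n x k)) (≤-reflexive (*-comm (suc (x / k)) k)))
    x≤ : x ≤ k * e
    x≤ = ≤-trans (≤-reflexive (sym (∣-∣-identityʳ x))) (ecc-∣-∣ ecc zero)
    q≤ : q ≤ k * e
    q≤ = ≤-trans (≤-trans (≤-reflexive (sym (m≤n⇒∣m-n∣≡n∸m (≤-pred (toℕ<n v))))) (≤-reflexive (cong (λ y → ∣ x - y ∣) (sym (toℕ-fromℕ (suc p)))))) (ecc-∣-∣ ecc (fromℕ (suc p)))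
    0<ke : 0 < k * e
    0<ke = n≢0⇒n>0 λ ke≡0 → 1+n≢0 (trans (sym x+q≡) (cong₂ _+_ (n≤0⇒n≡0 (≤-trans x≤ (≤-reflexive ke≡0))) (n≤0⇒n≡0 (≤-trans q≤ (≤-reflexive ke≡0)))))
    within : ∀ x → x ≤ k * e → suc ((x ∸ 1) / k) ≤ e
    -- If `v` is itself this end, truncation still asks for one layer, which the eccentricity allows
    -- since there are two vertices.
    within zero    _ = n≢0⇒n>0 λ { refl → <⇒≢ 0<ke (sym (*-zeroʳ k)) }
    within (suc x) x<ke = m<n*o⇒m/o<n (≤-trans x<ke (≤-reflexive (*-comm k e)))
    layers≤ : (x ∸ 1) / k + (q ∸ 1) / k ≤ E
    layers≤ = ≤-trans (≤-reflexive (sym (m*n/n≡m _ k))) (/-monoˡ-≤ k (≤-trans (≤-reflexive (*-distribʳ-+ k ((x ∸ 1) / k) ((q ∸ 1) / k)))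
      (≤-trans (+-mono-≤ (m/n*n≤m (x ∸ 1) k) (m/n*n≤m (q ∸ 1) k)) (both-pred x q x+q≡))))
      where
      both-pred : ∀ x q → x + q ≡ suc p → (x ∸ 1) + (q ∸ 1) ≤ p
      both-pred zero    q refl = ≤-refl
      both-pred (suc x) q refl = +-monoʳ-≤ x (m∸n≤m q 1)
    pairs = total (⌊_/2⌋ ∘ ext C) (2 + p)
    many-pairs : 2 ^ E ≤ pairs
    -- Fewer than 2^E pairs mean |C| ≤ 2^d - 2 + n. With s(D) ≤ t the size bound then gives (t -
    -- 1)(2^d - 1) ≤ k E, against k E ≤ (t - 1)(2^d - 2) and t ≥ 2.
    many-pairs = ≮⇒≥ λ few → 1+n≰n {0} (linear 0
        (total-halves (ext C) (2 + p) ⟨+⟩ (few ⟨+⟩ few) ⟨+⟩ ≤-trans (bound⇒ {C} big) (≤-reflexive (cong (_+ support D) (size≡ C)))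
          ⟨+⟩ ≤-trans (≤-reflexive (cong (λ t → t * 2 ^ suc E + p) (m+[n∸m]≡n 1≤t))) (pP-long k' t p) ⟨+⟩ ≤-trans support≤size (≤-reflexive (sym (m+[n∸m]≡n 1≤t)))
          ⟨+⟩ proj₁ bounds ⟨+⟩ proj₂ bounds)
        (arith (total (ext C) (2 + p)) pairs p (2 ^ E) (pP t (2 + p) k) (support D) (k * E) (t ∸ 1)))
      where
      bounds : k * E + (t ∸ 1) * 2 ≤ (t ∸ 1) * 2 ^ suc E × 1 ≤ t ∸ 1
      bounds = long-bound E (t ∸ 1) k (s≤s z≤n) (subst₂ (λ d t → ℚ.ceiling (t0Of d k) ℤ.< ℤ.+ t) (dP≡ k' t p) (sym (m+[n∸m]≡n 1≤t)) long)
      arith : ∀ c h p x P s kE u →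
        1 + (h + h + (2 + p) + (x + x) + (c + s) + (P + kE) + (1 + u) + u * (2 * x) + u) + 0 ≡
        0 + (c + (suc h + suc h) + suc P + ((1 + u) * (2 * x) + p) + s + (kE + u * 2) + 1)
      arith = solve-∀
    enough : 2 ^ ((x ∸ 1) / k + (q ∸ 1) / k) ≤ total (⌊_/2⌋ ∘ ext C) (suc (x + q))
    enough = ≤-trans (^-monoʳ-≤ 2 layers≤) (≤-trans many-pairs (≤-reflexive (cong (λ y → total (⌊_/2⌋ ∘ ext C) (suc y)) (sym x+q≡))))
  ... | c , c< , reach with steps (subst (λ m → Reach {k} m c (ext C) (pile (toℕ v) 1)) (m+[n∸m]≡n (≤-pred (toℕ<n v))) reach) C (λ v → ≤-reflexive (ext-toℕ C v))
  ...   | C' , s , v≤C' = c , C' , s , ≤-trans (≤-reflexive (sym (pile-self (toℕ v) 1))) (v≤C' v) , c<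

theorem30 : (n k t : ℕ) → .{{_ : NonZero k}} → 2 ≤ n → 1 ≤ t →
    (D : Config n) → size D ≡ t →
    AllSolvableFrom k D (pP t n k + 1 ∸ support D)
    × (Wide t n k → Small k D)
    × (StrictlyLong t n k →
    (C : Config n) → pP t n k + 1 ∸ support D ≤ size C →
    (v : Fin n) → 0 < D v → (e : ℕ) → IsEcc k v e →
    SolvesWithCost k C v (2 ^ e))
theorem30 n             zero     t   _ _   D _    = contradiction refl (≢-nonZero⁻¹ 0)
theorem30 (suc (suc p)) (suc k') .(size D) (s≤s (s≤s z≤n)) 1≤t D refl =
  all-solvable k' p D , wide⇒small k' p D 1≤t , λ long C big v _ → long⇒cheap k' p D 1≤t long C big v
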